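{- For all integers $n\geq 0$ and $i\geq 1$, $$\bar a_{9i}(9n+6)\equiv 0 \pmod{12},\qquad \bar a_{9i+4}(9n+6)\equiv 0\pmod{12},\qquad \bar a_{9i+8}(9n+6)\equiv 0\pmod{12}.$$
   Context: For an integer $k\geq 1$ let $f_k:=\prod_{n\geq 1}(1-q^{kn})$. For an integer $c\geq1$, the generalized overcubic partition function $\bar a_c(n)$ is defined by the generating function $\sum_{n\geq 0}\bar a_c(n)q^n=\dfrac{f_4^{c-1}}{f_1^2f_2^{2c-3}}$. -}

module Defs where

open import Algebra.Bundles using (CommutativeRing)
open import Data.Fin.Base using (Fin; zero; suc; toℕ)
open import Data.Integer.Base as ℤ using (ℤ; +_; -[1+_]; 0ℤ; 1ℤ)
import Data.Integer.Properties as ℤ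
open import Data.Nat.Base as ℕ using (ℕ; zero; suc; NonZero; _∸_)
import Data.Nat.Properties as ℕ
open import Data.Bool.Base using (if_then_else_)
open import Data.Vec.Base using (Vec; []; _∷_; head; lookup)
open import Relation.Binary.PropositionalEquality
open import Relation.Nullary.Decidable using (does; dec-false)

open import Algebra.Properties.Semiring.Sum
  (CommutativeRing.semiring ℤ.+-*-commutativeRing)
  using (sum-syntax; sum⁺-syntax; sum-cong-≗)

-- Formal power series over ℤ: A n is the coefficient of qⁿ.  Equality of
-- series is pointwise, since functions are not extensional here.

Series : Set
Series = ℕ → ℤ

infixl 6 _⊖_
infixl 7 _⊛_ _⊘_
infixr 8 _^_ _^ᶻ_

q^_ : ℕ → Series
(q^ m) n = if does (n ℕ.≟ m) then 1ℤ else 0ℤ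

one : Series
one = q^ 0

_⊖_ : Series → Series → Series
(A ⊖ B) n = A n ℤ.- B n

_⊛_ : Series → Series → Series
(A ⊛ B) n = ∑[ i ≤ n ] (A (toℕ i) ℤ.* B (n ∸ toℕ i))

-- Coefficients b n ∷ … ∷ b 0 of the reciprocal of A, found recursively from
-- b 0 = 1 and b (n+1) = - ∑_{i ≤ n} A (i+1) b (n-i).  This is meaningful
-- only if A has constant coefficient 1; see inv-inverse below.

invPrefix : Series → (n : ℕ) → Vec ℤ (suc n)
invPrefix A zero    = 1ℤ ∷ []
invPrefix A (suc n) =
  ℤ.- (∑[ i ≤ n ] (A (suc (toℕ i)) ℤ.* lookup (invPrefix A n) i)) ∷ invPrefix A n

inv : Series → Series
inv A n = head (invPrefix A n)

_⊘_ : Series → Series → Series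
A ⊘ B = A ⊛ inv B

_^_ : Series → ℕ → Series
A ^ zero  = one
A ^ suc n = A ⊛ A ^ n

_^ᶻ_ : Series → ℤ → Series
A ^ᶻ (+ n)    = A ^ n
A ^ᶻ -[1+ n ] = inv A ^ suc n

-- ∏_{1 ≤ m ≤ N} (1 - q^(k m))

partialProduct : ℕ → ℕ → Series
partialProduct k zero    = one
partialProduct k (suc N) = (one ⊖ q^ (k ℕ.* suc N)) ⊛ partialProduct k N

-- f k = ∏_{m ≥ 1} (1 - q^(k m)).  The coefficient of qⁿ is already final in
-- the n-th partial product; see f-limit below.

f : (k : ℕ) .{{_ : NonZero k}} → Series
f k n = partialProduct k n n

-- ∑ₙ ā c n qⁿ = f₄^(c-1) / (f₁² f₂^(2c-3)) for c ≥ 1.  The exponents are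
-- integers because 2c-3 is negative for c = 1; no truncated subtraction.

ā : ℕ → Series
ā c = f 4 ^ᶻ (+ c ℤ.- + 1) ⊘ (f 1 ^ 2 ⊛ f 2 ^ᶻ (+ 2 ℤ.* + c ℤ.- + 3))

private
  lookup-invPrefix : ∀ A n (i : Fin (suc n)) → lookup (invPrefix A n) i ≡ inv A (n ∸ toℕ i)
  lookup-invPrefix A zero    zero    = refl
  lookup-invPrefix A (suc n) zero    = refl
  lookup-invPrefix A (suc n) (suc i) = lookup-invPrefix A n i

  sum-zero : ∀ n (t : Fin n → ℤ) → (∀ i → t i ≡ 0ℤ) → ∑[ i < n ] t i ≡ 0ℤ
  sum-zero zero    t t≡0 = refl
  sum-zero (suc n) t t≡0 = cong₂ ℤ._+_ (t≡0 zero) (sum-zero n (λ i → t (suc i)) (λ i → t≡0 (suc i)))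

  ⊛-low : ∀ m A n → n ℕ.< m → ((one ⊖ q^ m) ⊛ A) n ≡ A n
  ⊛-low (suc m) A n n<m = trans
    (cong₂ ℤ._+_ (ℤ.*-identityˡ (A n)) (sum-zero n _ tail≡0)) (ℤ.+-identityʳ (A n))
    where
    open import Data.Fin.Properties using (toℕ<n)
    tail≡0 : ∀ (i : Fin n) →
             (one ⊖ q^ suc m) (suc (toℕ i)) ℤ.* A (n ∸ suc (toℕ i)) ≡ 0ℤ
    tail≡0 i rewrite dec-false (suc (toℕ i) ℕ.≟ suc m)
                       (ℕ.<⇒≢ (ℕ.≤-<-trans (toℕ<n i) n<m)) = refl

inv-inverse : ∀ A → A 0 ≡ 1ℤ → ∀ n → (A ⊛ inv A) n ≡ one n
inv-inverse A A0≡1 zero    rewrite A0≡1 = refl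
inv-inverse A A0≡1 (suc n) = begin
  A 0 ℤ.* (ℤ.- s) ℤ.+ (∑[ i ≤ n ] (A (suc (toℕ i)) ℤ.* inv A (n ∸ toℕ i)))
    ≡⟨ cong₂ ℤ._+_ (trans (cong (ℤ._* (ℤ.- s)) A0≡1) (ℤ.*-identityˡ (ℤ.- s)))
         (sum-cong-≗ {suc n} (λ i → cong (A (suc (toℕ i)) ℤ.*_) (sym (lookup-invPrefix A n i)))) ⟩
  ℤ.- s ℤ.+ s
    ≡⟨ ℤ.+-inverseˡ s ⟩
  0ℤ ∎
  where
  open ≡-Reasoning
  s = ∑[ i ≤ n ] (A (suc (toℕ i)) ℤ.* lookup (invPrefix A n) i)

f-limit : ∀ k .{{_ : NonZero k}} n d → partialProduct k (d ℕ.+ n) n ≡ f k n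
f-limit k n zero    = refl
f-limit k n (suc d) = trans
  (⊛-low (k ℕ.* suc (d ℕ.+ n)) (partialProduct k (d ℕ.+ n)) n
    (ℕ.≤-trans (ℕ.s≤s (ℕ.m≤n+m n d)) (ℕ.m≤n*m (suc (d ℕ.+ n)) k)))
  (f-limit k n d)

{-# OPTIONS --safe #-}
module Submission where

-- Gauss's identity f₁² = f₂ T with T = ∑ (-1)^j q^(j²), and its version
-- f₂² = f₄ U in q², turn the generating function into 1 / (T U^(c-1)).
--
-- Modulo 4, T² = U² = 1, so ā c is T or T U = T + U - 1, and 9n+6 is neither a
-- square nor twice a square.
--
-- Modulo 3, let P = T(-q).  Then T P = U², and (with P² + T² = 2 P(q²)²)
-- E = T⁴ + P⁴ satisfies E(q) = E(q²), hence E = 2.  It follows that U^18 / (T U^(c-1))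
-- is, up to a power of U⁹ = U(q⁹), equal to T⁴ P⁵ = - (P⁵ + P⁹), T² P³ or P in the
-- three cases.  Since P³ = P(q³), exponents congruent to 6 modulo 9 would need
-- 3a² + b² + c² ≡ 6 (mod 9), which is impossible.

open import Algebra.Bundles using (CommutativeRing)
open import Algebra.Solver.Ring.AlmostCommutativeRing
  using (fromCommutativeRing; _-Raw-AlmostCommutative⟶_)
open import Data.Empty using (⊥; ⊥-elim)
open import Data.Fin.Base using (Fin; zero; suc; toℕ; fromℕ<)
open import Data.Fin.Properties using (toℕ<n; toℕ-fromℕ<; all?)
open import Data.Integer.Base as ℤ using (ℤ; +_; 0ℤ; 1ℤ)
open import Data.Integer.Divisibility.Signed as ℤ∣ using (divides) renaming (_∣_ to _∣ᶻ_)
import Data.Integer.Properties as ℤ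
import Data.Integer.Solver as ℤ
open import Data.List.Base using (List; []; _∷_)
open import Data.List.Relation.Unary.Any using (here; there)
import Data.Maybe.Base as Maybe
open import Data.Nat.Base as ℕ using (ℕ; zero; suc; _∸_; _<_; _≤_; NonZero; z≤n; s≤s)
open import Data.Nat.DivMod using (_%_; m%n<n; m%n%n≡m%n; [m+kn]%n≡m%n; %-distribˡ-+; %-distribˡ-*)
import Data.Nat.Divisibility as ℕ∣
open import Data.Nat.Induction using (<-rec)
open import Data.Nat.LCM using (lcm-least)
import Data.Nat.Properties as ℕ
open import Data.List.Membership.DecPropositional ℕ._≟_ using (_∈_; _∈?_)
open import Data.Nat.Solver using (module +-*-Solver)
open import Data.Product.Base using (_,_; ∃-syntax)
open import Data.Sum.Base using (_⊎_; inj₁; inj₂; [_,_]′)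
open import Relation.Binary.PropositionalEquality as ≡ using (_≡_)
open import Relation.Nullary using (¬_; Dec; yes; no)
open import Relation.Nullary.Decidable using (True; toWitness; _→-dec_; dec-false; dec⇒maybe)
open import Relation.Unary using (Decidable)
open import Algebra.Properties.Semiring.Sum
  (CommutativeRing.semiring ℤ.+-*-commutativeRing)
  using (sum-syntax; sum⁺-syntax; sum-cong-≗; sum-replicate-zero; *-distribˡ-sum; ∑-distrib-+)

-- Infinite products and theta series are awkward to manipulate coefficientwise, so congruences live
-- in the ring of series modulo `m` and modulo q^N, with N just above the coefficient in question.
-- There every monomial of positive degree is nilpotent: products and theta series may be cut off,
-- Gauss's identity becomes an identity of finite expressions, and the passage from E(q) = E(q²) to
-- E = 2 needs finitely many doublings instead of a limit. The identities are proved over an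
-- abstract commutative ring, so that the same lemma can be used at q, -q, q² and q^a, and for both
-- moduli.
--
-- Which exponents occur is a separate matter, recorded for the integer coefficients themselves. The
-- two sides meet only when a congruence is read off at a coefficient where one side is exactly
-- zero. A power such as P³ must therefore be traded for the congruent series P(q³) before its
-- exponents are examined.

module Theta {c ℓ} (R : CommutativeRing c ℓ)
  (ι : ℤ.+-*-rawRing -Raw-AlmostCommutative⟶ fromCommutativeRing R) where

  open CommutativeRing R hiding (zero)
  open import Algebra.Properties.Ring ring using (-‿distribʳ-*; -0#≈0#)
  open import Algebra.Properties.Semiring.Exp semiring
  open import Algebra.Properties.CommutativeSemiring.Exp commutativeSemiring using (^-distrib-*)
  open import Algebra.Solver.Ring ℤ.+-*-rawRing (fromCommutativeRing R) ι
    (λ x y → Maybe.map (λ x≡y → reflexive (≡.cong (_-Raw-AlmostCommutative⟶_.⟦_⟧ ι) x≡y))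
       (dec⇒maybe (x ℤ.≟ y)))
    public
    using (Polynomial; var; solve; _:+_; _:*_; _:-_; :-_; _:^_; _:=_)
  open import Relation.Binary.Reasoning.Setoid setoid

  private
    -- con 1ℤ would denote ι 1ℤ, which is not definitionally 1#.
    :1 : ∀ {n} → Polynomial (suc n)
    :1 = var zero :^ 0

  -- Gauss's identity in finite form.

  double : Carrier → Carrier
  double x = x + x

  double-cong : ∀ {x y} → x ≈ y → double x ≈ double y
  double-cong p = +-cong p p

  -- The summand (- x^k)^k of θ is (-1)^k x^(k²).

  ∏⁻ ∏⁺ θ : ℕ → Carrier → Carrier
  ∏⁻ zero    x = 1#
  ∏⁻ (suc n) x = (1# - x ^ suc n) * ∏⁻ n x
  ∏⁺ zero    x = 1#
  ∏⁺ (suc n) x = (1# + x ^ suc n) * ∏⁺ n x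
  θ zero    x = 1#
  θ (suc n) x = θ n x + double ((- (x ^ suc n)) ^ suc n)

  ∏⁺*∏⁻ : ∀ n x → ∏⁺ n x * ∏⁻ n x ≈ ∏⁻ n (x * x)
  ∏⁺*∏⁻ zero    x = *-identityˡ 1#
  ∏⁺*∏⁻ (suc n) x = begin
    (1# + p) * ∏⁺ n x * ((1# - p) * ∏⁻ n x)
      ≈⟨ solve 3 (λ p m n → (:1 :+ p) :* m :* ((:1 :- p) :* n) := (:1 :- p :* p) :* (m :* n)) refl p (∏⁺ n x) (∏⁻ n x) ⟩
    (1# - p * p) * (∏⁺ n x * ∏⁻ n x)
      ≈⟨ *-cong (+-congˡ (-‿cong (sym (^-distrib-* x x (suc n))))) (∏⁺*∏⁻ n x) ⟩
    ∏⁻ (suc n) (x * x) ∎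
    where p = x ^ suc n

  -- A deformation between the two sides of Gauss's identity ∏⁺ θ = ∏⁻ (compare
  -- Shanks's finite form of Euler's pentagonal number theorem): the left-hand side is its
  -- value at y = x^(n+1), the right-hand side its value at y = 0.

  gaussSum : Carrier → Carrier → ℕ → Carrier
  gaussSum x y zero    = 1#
  gaussSum x y (suc t) = (1# - x ^ suc t) * gaussSum x y t + double ((- y) ^ suc t * ∏⁺ t x)

  -‿*-^ : ∀ x y n → (- (x * y)) ^ n ≈ x ^ n * (- y) ^ n
  -‿*-^ x y n = trans (^-congˡ n (-‿distribʳ-* x y)) (^-distrib-* x (- y) n)

  -- The defect `double ((- y) ^ suc t * ∏⁺ t x)` reproduces itself under the recursion in `t`, so
  -- induction closes. The factor `1# - y` never has to be cancelled: at y = x^(t+1) it is the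
  -- factor with which `gaussSum` begins its next step.
  gaussSum-shift : ∀ x y t →
    (1# - y) * gaussSum x (x * y) t ≈ (1# + y) * gaussSum x y t + double ((- y) ^ suc t * ∏⁺ t x)
  gaussSum-shift x y zero = solve 1 (λ y →
    (:1 :- y) :* :1 := (:1 :+ y) :* :1 :+ (((:- y) :* :1 :* :1) :+ ((:- y) :* :1 :* :1))) refl y
  gaussSum-shift x y (suc t) = begin
    (1# - y) * ((1# - p) * s′ + double ((- (x * y)) ^ suc t * m))
      ≈⟨ *-congˡ (+-congˡ (double-cong (*-congʳ (-‿*-^ x y (suc t))))) ⟩
    (1# - y) * ((1# - p) * s′ + double (p * w * m))
      ≈⟨ solve 5 (λ y p s′ w m →
           (:1 :- y) :* ((:1 :- p) :* s′ :+ (p :* w :* m :+ p :* w :* m)) :=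
           (:1 :- p) :* ((:1 :- y) :* s′) :+ (:1 :- y) :* (p :* w :* m :+ p :* w :* m)) refl y p s′ w m ⟩
    (1# - p) * ((1# - y) * s′) + (1# - y) * double (p * w * m)
      ≈⟨ +-congʳ (*-congˡ (gaussSum-shift x y t)) ⟩
    (1# - p) * ((1# + y) * s + double (w * m)) + (1# - y) * double (p * w * m)
      ≈⟨ solve 5 (λ y p s w m →
           (:1 :- p) :* ((:1 :+ y) :* s :+ (w :* m :+ w :* m)) :+ (:1 :- y) :* (p :* w :* m :+ p :* w :* m) :=
           (:1 :+ y) :* ((:1 :- p) :* s :+ (w :* m :+ w :* m))
             :+ (:- y :* w :* ((:1 :+ p) :* m) :+ :- y :* w :* ((:1 :+ p) :* m))) refl y p s w m ⟩
    (1# + y) * ((1# - p) * s + double (w * m)) + double (- y * w * ((1# + p) * m)) ∎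
    where
    p = x ^ suc t
    m = ∏⁺ t x
    w = (- y) ^ suc t
    s = gaussSum x y t
    s′ = gaussSum x (x * y) t

  -- Passing to `suc n` changes both the length and the deformation parameter. The new leading
  -- factor `1# - p` is exactly what `gaussSum-shift` asks for at `y = p`; the two defects w m and p
  -- w m, both doubled, then add up to `(1# + p) * m` times the new summand of `θ`.
  gaussSum-θ : ∀ x n → gaussSum x (x ^ suc n) n ≈ ∏⁺ n x * θ n x
  gaussSum-θ x zero    = sym (*-identityˡ 1#)
  gaussSum-θ x (suc n) = begin
    (1# - p) * gaussSum x (x * p) n + double ((- (x * p)) ^ suc n * m)
      ≈⟨ +-cong (gaussSum-shift x p n) (double-cong (*-congʳ (-‿*-^ x p (suc n)))) ⟩
    (1# + p) * gaussSum x p n + double (w * m) + double (p * w * m)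
      ≈⟨ +-congʳ (+-congʳ (*-congˡ (gaussSum-θ x n))) ⟩
    (1# + p) * (m * θ n x) + double (w * m) + double (p * w * m)
      ≈⟨ solve 4 (λ p m s w →
           (:1 :+ p) :* (m :* s) :+ (w :* m :+ w :* m) :+ (p :* w :* m :+ p :* w :* m) :=
           (:1 :+ p) :* m :* (s :+ (w :+ w))) refl p m (θ n x) w ⟩
    (1# + p) * m * (θ n x + double w) ∎
    where
    p = x ^ suc n
    m = ∏⁺ n x
    w = (- p) ^ suc n

  gaussSum-0 : ∀ x y t → y ≈ 0# → gaussSum x y t ≈ ∏⁻ t x
  gaussSum-0 x y zero    y≈0 = refl
  gaussSum-0 x y (suc t) y≈0 = begin
    (1# - x ^ suc t) * gaussSum x y t + double (- y * w * m)
      ≈⟨ +-cong (*-congˡ (gaussSum-0 x y t y≈0)) (double-cong (*-congʳ (*-congʳ (-‿cong y≈0)))) ⟩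
    (1# - x ^ suc t) * ∏⁻ t x + double (- 0# * w * m)
      ≈⟨ +-congˡ (double-cong (trans (*-congʳ (trans (*-congʳ -0#≈0#) (zeroˡ w))) (zeroˡ m))) ⟩
    (1# - x ^ suc t) * ∏⁻ t x + double 0#
      ≈⟨ trans (+-congˡ (+-identityˡ 0#)) (+-identityʳ _) ⟩
    ∏⁻ (suc t) x ∎
    where
    w = (- y) ^ t
    m = ∏⁺ t x

  -- The vanishing of x^(n+1) makes the two ends of the deformation coincide. Multiplying ∏⁻ = ∏⁺ θ
  -- by ∏⁻ then merges ∏⁺ and ∏⁻ into the product at x².
  gauss : ∀ n x → x ^ suc n ≈ 0# → ∏⁻ n x * ∏⁻ n x ≈ ∏⁻ n (x * x) * θ n x
  gauss n x x^≈0 = begin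
    ∏⁻ n x * ∏⁻ n x
      ≈⟨ *-congʳ (trans (sym (gaussSum-0 x (x ^ suc n) n x^≈0)) (gaussSum-θ x n)) ⟩
    ∏⁺ n x * θ n x * ∏⁻ n x
      ≈⟨ solve 3 (λ a b c → a :* b :* c := a :* c :* b) refl (∏⁺ n x) (θ n x) (∏⁻ n x) ⟩
    ∏⁺ n x * ∏⁻ n x * θ n x
      ≈⟨ *-congʳ (∏⁺*∏⁻ n x) ⟩
    ∏⁻ n (x * x) * θ n x ∎

  ∏⁻-cong : ∀ n {x y} → x ≈ y → ∏⁻ n x ≈ ∏⁻ n y
  ∏⁻-cong zero    x≈y = refl
  ∏⁻-cong (suc n) x≈y = *-cong (+-congˡ (-‿cong (^-congˡ (suc n) x≈y))) (∏⁻-cong n x≈y)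

  θ-cong : ∀ n {x y} → x ≈ y → θ n x ≈ θ n y
  θ-cong zero    x≈y = refl
  θ-cong (suc n) x≈y = +-cong (θ-cong n x≈y)
    (double-cong (^-congˡ (suc n) (-‿cong (^-congˡ (suc n) x≈y))))

  θ-0 : ∀ n {x} → x ≈ 0# → θ n x ≈ 1#
  θ-0 zero    x≈0 = refl
  θ-0 (suc n) {x} x≈0 = begin
    θ n x + double ((- (x ^ suc n)) ^ suc n)
      ≈⟨ +-cong (θ-0 n x≈0) (double-cong (trans (*-congʳ -x^≈0) (zeroˡ _))) ⟩
    1# + double 0#
      ≈⟨ trans (+-congˡ (+-identityʳ 0#)) (+-identityʳ 1#) ⟩
    1# ∎
    where
    -x^≈0 : - (x ^ suc n) ≈ 0#
    -x^≈0 = trans (-‿cong (trans (*-congʳ x≈0) (zeroˡ _))) -0#≈0#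

  -- The product of theta at `x` and at `- x`.

  ^-zero-mono : ∀ d n {x} → x ^ n ≈ 0# → x ^ (d ℕ.+ n) ≈ 0#
  ^-zero-mono d n {x} x^≈0 = trans (^-homo-* x d n) (trans (*-congˡ x^≈0) (zeroʳ (x ^ d)))

  ∏⁻-stable : ∀ d n {x} → x ^ suc n ≈ 0# → ∏⁻ (d ℕ.+ n) x ≈ ∏⁻ n x
  ∏⁻-stable zero    n x^≈0 = refl
  ∏⁻-stable (suc d) n {x} x^≈0 = begin
    (1# - x ^ suc (d ℕ.+ n)) * ∏⁻ (d ℕ.+ n) x
      ≈⟨ *-cong (+-congˡ (-‿cong x^′≈0)) (∏⁻-stable d n x^≈0) ⟩
    (1# - 0#) * ∏⁻ n x
      ≈⟨ *-congʳ (trans (+-congˡ -0#≈0#) (+-identityʳ 1#)) ⟩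
    1# * ∏⁻ n x
      ≈⟨ *-identityˡ _ ⟩
    ∏⁻ n x ∎
    where
    x^′≈0 : x ^ suc (d ℕ.+ n) ≈ 0#
    x^′≈0 = trans (^-congʳ x (≡.sym (ℕ.+-suc d n))) (^-zero-mono d (suc n) x^≈0)

  -‿^-even : ∀ x m → (- x) ^ (m ℕ.* 2) ≈ x ^ (m ℕ.* 2)
  -‿^-even x zero    = refl
  -‿^-even x (suc m) = trans (*-congˡ (*-congˡ (-‿^-even x m)))
    (solve 2 (λ x p → (:- x) :* ((:- x) :* p) := x :* (x :* p)) refl x (x ^ (m ℕ.* 2)))

  -‿^-odd : ∀ x m → (- x) ^ suc (m ℕ.* 2) ≈ - (x ^ suc (m ℕ.* 2))
  -‿^-odd x m = trans (*-congˡ (-‿^-even x m))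
    (solve 2 (λ x p → (:- x) :* p := :- (x :* p)) refl x (x ^ (m ℕ.* 2)))

  -- Finite form of f(-q) = f₂³ / (f₁ f₄). At an odd index the factors 1 + a and 1 - a of the first
  -- two products combine to 1 - a²; at an even index both are 1 - b, a factor of the half-length
  -- product at x². The lengths `m * 2` and `m` are matched so that the identity is exact at every
  -- stage.
  ∏⁻-negate : ∀ m x → ∏⁻ (m ℕ.* 2) (- x) * ∏⁻ (m ℕ.* 2) x * ∏⁻ m ((x * x) * (x * x))
                      ≈ ∏⁻ (m ℕ.* 2) (x * x) * (∏⁻ m (x * x) * ∏⁻ m (x * x))
  ∏⁻-negate zero    x = *-assoc 1# 1# 1#
  ∏⁻-negate (suc m) x = begin
    (1# - (- x) ^ suc k) * ((1# - (- x) ^ k) * F₁) * ((1# - x ^ suc k) * ((1# - x ^ k) * F₂))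
      * ((1# - ((x * x) * (x * x)) ^ suc m) * F₃)
      ≈⟨ *-cong (*-congʳ (*-cong (+-congˡ (-‿cong (-‿^-even x (suc m)))) (*-congʳ (+-congˡ (-‿cong (-‿^-odd x m))))))
                (*-congʳ (+-congˡ (-‿cong (trans (^-distrib-* (x * x) (x * x) (suc m)) (*-cong square square))))) ⟩
    (1# - b) * ((1# - (- a)) * F₁) * ((1# - b) * ((1# - a) * F₂)) * ((1# - b * b) * F₃)
      ≈⟨ solve 5 (λ a b f g h →
           (:1 :- b) :* ((:1 :- (:- a)) :* f) :* ((:1 :- b) :* ((:1 :- a) :* g)) :* ((:1 :- b :* b) :* h) :=
           ((:1 :- b :* b) :* (:1 :- a :* a) :* ((:1 :- b) :* (:1 :- b))) :* (f :* g :* h)) refl a b F₁ F₂ F₃ ⟩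
    (1# - b * b) * (1# - a * a) * ((1# - b) * (1# - b)) * (F₁ * F₂ * F₃)
      ≈⟨ *-congˡ (∏⁻-negate m x) ⟩
    (1# - b * b) * (1# - a * a) * ((1# - b) * (1# - b)) * (G₁ * (G₂ * G₂))
      ≈⟨ solve 4 (λ a b f g →
           (:1 :- b :* b) :* (:1 :- a :* a) :* ((:1 :- b) :* (:1 :- b)) :* (f :* (g :* g)) :=
           (:1 :- b :* b) :* ((:1 :- a :* a) :* f) :* ((:1 :- b) :* g :* ((:1 :- b) :* g))) refl a b G₁ G₂ ⟩
    (1# - b * b) * ((1# - a * a) * G₁) * ((1# - b) * G₂ * ((1# - b) * G₂))
      ≈⟨ *-cong (*-cong (+-congˡ (-‿cong (sym (^-distrib-* x x (suc k))))) (*-congʳ (+-congˡ (-‿cong (sym (^-distrib-* x x k))))))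
                (*-cong (*-congʳ 1-square) (*-congʳ 1-square)) ⟩
    ∏⁻ (suc m ℕ.* 2) (x * x) * (∏⁻ (suc m) (x * x) * ∏⁻ (suc m) (x * x)) ∎
    where
    k = suc (m ℕ.* 2)
    a = x ^ k
    b = x ^ suc k
    F₁ = ∏⁻ (m ℕ.* 2) (- x)
    F₂ = ∏⁻ (m ℕ.* 2) x
    F₃ = ∏⁻ m ((x * x) * (x * x))
    G₁ = ∏⁻ (m ℕ.* 2) (x * x)
    G₂ = ∏⁻ m (x * x)
    square : (x * x) ^ suc m ≈ b
    square = begin
      (x * x) ^ suc m     ≈⟨ ^-congˡ (suc m) (*-congˡ (sym (*-identityʳ x))) ⟩
      (x ^ 2) ^ suc m     ≈⟨ ^-assocʳ x 2 (suc m) ⟩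
      x ^ (2 ℕ.* suc m)   ≈⟨ ^-congʳ x (ℕ.*-comm 2 (suc m)) ⟩
      b                   ∎
    1-square : 1# - b ≈ 1# - (x * x) ^ suc m
    1-square = +-congˡ (-‿cong (sym square))

  cancelˡ : ∀ {u v x y} → u * v ≈ 1# → u * x ≈ u * y → x ≈ y
  cancelˡ {u} {v} {x} {y} uv≈1 ux≈uy = begin
    x            ≈⟨ sym (*-identityˡ x) ⟩
    1# * x       ≈⟨ *-congʳ uv≈1 ⟨
    u * v * x    ≈⟨ solve 3 (λ u v x → u :* v :* x := v :* (u :* x)) refl u v x ⟩
    v * (u * x)  ≈⟨ *-congˡ ux≈uy ⟩
    v * (u * y)  ≈⟨ solve 3 (λ u v x → v :* (u :* x) := u :* v :* x) refl u v y ⟩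
    u * v * y    ≈⟨ *-congʳ uv≈1 ⟩
    1# * y       ≈⟨ *-identityˡ y ⟩
    y            ∎

  -- Gauss's identity expresses each theta value by products. After multiplication by G² H² both
  -- sides equal G⁶: on the left F² F⁻² H² is the square of `∏⁻-negate`, on the right H S₂ = G². The
  -- inverses `v` and `w` serve to cancel G² H².
  θ-negate : ∀ m x {v w} → x ^ suc m ≈ 0# →
    ∏⁻ (m ℕ.* 2) (x * x) * v ≈ 1# → ∏⁻ (m ℕ.* 2) ((x * x) * (x * x)) * w ≈ 1# →
    θ (m ℕ.* 2) x * θ (m ℕ.* 2) (- x) ≈ θ (m ℕ.* 2) (x * x) * θ (m ℕ.* 2) (x * x)
  θ-negate m x {v} {w} x^≈0 unit₂ unit₄ =
    cancelˡ {G * G * (H * H)} {v * v * (w * w)} unit (begin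
    G * G * (H * H) * (S * S⁻)
      ≈⟨ solve 4 (λ g h s t → g :* g :* (h :* h) :* (s :* t) := g :* s :* (g :* t) :* (h :* h)) refl G H S S⁻ ⟩
    G * S * (G * S⁻) * (H * H)
      ≈⟨ *-congʳ (*-cong (gauss L x x^L) gauss⁻) ⟨
    F * F * (F⁻ * F⁻) * (H * H)
      ≈⟨ solve 3 (λ f g h → f :* f :* (g :* g) :* (h :* h) := (g :* f :* h) :* (g :* f :* h)) refl F F⁻ H ⟩
    (F⁻ * F * H) * (F⁻ * F * H)
      ≈⟨ *-cong FFH FFH ⟩
    G * (G * G) * (G * (G * G))
      ≈⟨ solve 1 (λ g → g :* (g :* g) :* (g :* (g :* g)) := g :* g :* ((g :* g) :* (g :* g))) refl G ⟩
    G * G * ((G * G) * (G * G))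
      ≈⟨ *-congˡ (*-cong (gauss L (x * x) x²^L) (gauss L (x * x) x²^L)) ⟩
    G * G * ((H * S₂) * (H * S₂))
      ≈⟨ solve 3 (λ g h s → g :* g :* ((h :* s) :* (h :* s)) := g :* g :* (h :* h) :* (s :* s)) refl G H S₂ ⟩
    G * G * (H * H) * (S₂ * S₂) ∎)
    where
    L = m ℕ.* 2
    F = ∏⁻ L x
    F⁻ = ∏⁻ L (- x)
    G = ∏⁻ L (x * x)
    H = ∏⁻ L ((x * x) * (x * x))
    S = θ L x
    S⁻ = θ L (- x)
    S₂ = θ L (x * x)
    L≡ : m ℕ.+ m ≡ L
    L≡ = ≡.trans (≡.cong (m ℕ.+_) (≡.sym (ℕ.+-identityʳ m))) (ℕ.*-comm 2 m)
    sucL : m ℕ.+ suc m ≡ suc L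
    sucL = ≡.trans (ℕ.+-suc m m) (≡.cong suc L≡)
    x^L : x ^ suc L ≈ 0#
    x^L = trans (^-congʳ x (≡.sym sucL)) (^-zero-mono m (suc m) x^≈0)
    -x^L : (- x) ^ suc L ≈ 0#
    -x^L = trans (-‿^-odd x m) (trans (-‿cong x^L) -0#≈0#)
    square-zero : ∀ n {y} → y ^ n ≈ 0# → (y * y) ^ n ≈ 0#
    square-zero n {y} y^≈0 = trans (^-distrib-* y y n) (trans (*-congˡ y^≈0) (zeroʳ _))
    x²^L : (x * x) ^ suc L ≈ 0#
    x²^L = square-zero (suc L) x^L
    stable : ∀ {y} → y ^ suc m ≈ 0# → ∏⁻ L y ≈ ∏⁻ m y
    stable {y} p = trans (reflexive (≡.cong (λ l → ∏⁻ l y) (≡.sym L≡))) (∏⁻-stable m m p)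
    FFH : F⁻ * F * H ≈ G * (G * G)
    FFH = begin
      -- `∏⁻-negate` involves products of lengths `m` and `m * 2`; since x^(m+1) vanishes, these
      -- agree at x² and at x⁴.
      F⁻ * F * H                            ≈⟨ *-congˡ (stable (square-zero (suc m) (square-zero (suc m) x^≈0))) ⟩
      F⁻ * F * ∏⁻ m ((x * x) * (x * x))     ≈⟨ ∏⁻-negate m x ⟩
      G * (∏⁻ m (x * x) * ∏⁻ m (x * x))     ≈⟨ *-congˡ (*-cong st st) ⟨
      G * (G * G)                           ∎
      where st = stable (square-zero (suc m) x^≈0)
    gauss⁻ : F⁻ * F⁻ ≈ G * S⁻
    gauss⁻ = trans (gauss L (- x) -x^L)
      (*-congʳ (∏⁻-cong L (solve 1 (λ x → (:- x) :* (:- x) := x :* x) refl x)))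
    unit : G * G * (H * H) * (v * v * (w * w)) ≈ 1#
    unit = begin
      G * G * (H * H) * (v * v * (w * w))
        ≈⟨ solve 4 (λ g h v w → g :* g :* (h :* h) :* (v :* v :* (w :* w)) :=
             (g :* v) :* (g :* v) :* ((h :* w) :* (h :* w))) refl G H v w ⟩
      (G * v) * (G * v) * ((H * w) * (H * w))
        ≈⟨ *-cong (*-cong unit₂ unit₂) (*-cong unit₄ unit₄) ⟩
      1# * 1# * (1# * 1#)
        ≈⟨ trans (*-cong (*-identityˡ 1#) (*-identityˡ 1#)) (*-identityˡ 1#) ⟩
      1# ∎

  -- Splitting theta by the parity of the summation index.

  θ-even θ-odd : ℕ → Carrier → Carrier
  θ-even zero    x = 1#
  θ-even (suc m) x = θ-even m x + double (x ^ (suc m ℕ.* 2 ℕ.* (suc m ℕ.* 2)))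
  θ-odd zero    x = 0#
  θ-odd (suc m) x = θ-odd m x + double (x ^ (suc (m ℕ.* 2) ℕ.* suc (m ℕ.* 2)))

  private
    even-term : ∀ x m → (- (x ^ (m ℕ.* 2))) ^ (m ℕ.* 2) ≈ x ^ (m ℕ.* 2 ℕ.* (m ℕ.* 2))
    even-term x m = trans (-‿^-even (x ^ (m ℕ.* 2)) m) (^-assocʳ x (m ℕ.* 2) (m ℕ.* 2))

    odd-term : ∀ x m → (- (x ^ suc (m ℕ.* 2))) ^ suc (m ℕ.* 2) ≈ - (x ^ (suc (m ℕ.* 2) ℕ.* suc (m ℕ.* 2)))
    odd-term x m = trans (-‿^-odd (x ^ suc (m ℕ.* 2)) m) (-‿cong (^-assocʳ x (suc (m ℕ.* 2)) (suc (m ℕ.* 2))))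

  θ-split : ∀ m x → θ (m ℕ.* 2) x ≈ θ-even m x - θ-odd m x
  θ-split zero    x = sym (trans (+-congˡ -0#≈0#) (+-identityʳ 1#))
  θ-split (suc m) x = trans
    (+-cong (+-cong (θ-split m x) (double-cong (odd-term x m))) (double-cong (even-term x (suc m))))
    (solve 4 (λ a b c d → a :- b :+ (:- c :+ :- c) :+ (d :+ d) := a :+ (d :+ d) :- (b :+ (c :+ c))) refl
      (θ-even m x) (θ-odd m x) _ _)

  θ-even-negate : ∀ m x → θ-even m (- x) ≈ θ-even m x
  θ-even-negate zero    x = refl
  θ-even-negate (suc m) x = +-cong (θ-even-negate m x) (double-cong (begin
    (- x) ^ (k ℕ.* k)  ≈⟨ ^-assocʳ (- x) k k ⟨
    ((- x) ^ k) ^ k    ≈⟨ ^-congˡ k (-‿^-even x (suc m)) ⟩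
    (x ^ k) ^ k        ≈⟨ ^-assocʳ x k k ⟩
    x ^ (k ℕ.* k)      ∎))
    where k = suc m ℕ.* 2

  θ-odd-negate : ∀ m x → θ-odd m (- x) ≈ - θ-odd m x
  θ-odd-negate zero    x = sym -0#≈0#
  θ-odd-negate (suc m) x = trans
    (+-cong (θ-odd-negate m x) (double-cong (begin
      (- x) ^ (k ℕ.* k)  ≈⟨ ^-assocʳ (- x) k k ⟨
      ((- x) ^ k) ^ k    ≈⟨ ^-congˡ k (-‿^-odd x m) ⟩
      (- (x ^ k)) ^ k    ≈⟨ odd-term x m ⟩
      - (x ^ (k ℕ.* k))  ∎)))
    (solve 2 (λ b t → :- b :+ (:- t :+ :- t) := :- (b :+ (t :+ t))) refl (θ-odd m x) (x ^ (k ℕ.* k)))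
    where k = suc (m ℕ.* 2)

  θ-split⁻ : ∀ m x → θ (m ℕ.* 2) (- x) ≈ θ-even m x + θ-odd m x
  θ-split⁻ m x = begin
    θ (m ℕ.* 2) (- x)                  ≈⟨ θ-split m (- x) ⟩
    θ-even m (- x) - θ-odd m (- x)     ≈⟨ +-cong (θ-even-negate m x) (-‿cong (θ-odd-negate m x)) ⟩
    θ-even m x - (- θ-odd m x)         ≈⟨ solve 2 (λ a b → a :- (:- b) := a :+ b) refl (θ-even m x) (θ-odd m x) ⟩
    θ-even m x + θ-odd m x             ∎

  -- Consequences in characteristic 3.

  module Characteristic3 (three≈0 : 1# + 1# + 1# ≈ 0#) where

    +-triple : ∀ x y → x + (1# + 1# + 1#) * y ≈ x
    +-triple x y = trans (+-congˡ (trans (*-congʳ three≈0) (zeroˡ y))) (+-identityʳ x)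

    -- Cubing is additive here and sends 2 w to 8 w³ = 2 w³, so it acts on each summand separately;
    -- the signs survive because 3 is odd.
    θ-cube : ∀ n x → θ n x ^ 3 ≈ θ n (x ^ 3)
    θ-cube zero    x = solve 1 (λ x → :1 :^ 3 := :1) refl x
    θ-cube (suc n) x = begin
      (s + double w) ^ 3
        ≈⟨ solve 2 (λ s w → (s :+ (w :+ w)) :^ 3 :=
             s :^ 3 :+ (w :^ 3 :+ w :^ 3) :+ (:1 :+ :1 :+ :1) :*
               (s :* s :* (w :+ w) :+ s :* (w :+ w) :* (w :+ w) :+ (w :^ 3 :+ w :^ 3))) refl s w ⟩
      s ^ 3 + double (w ^ 3) + (1# + 1# + 1#) * _
        ≈⟨ +-triple _ _ ⟩
      s ^ 3 + double (w ^ 3)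
        ≈⟨ +-cong (θ-cube n x) (double-cong w³) ⟩
      θ (suc n) (x ^ 3) ∎
      where
      k = suc n
      s = θ n x
      w = (- (x ^ k)) ^ k
      swap : ∀ y i j → (y ^ i) ^ j ≈ (y ^ j) ^ i
      swap y i j = trans (^-assocʳ y i j) (trans (^-congʳ y (ℕ.*-comm i j)) (sym (^-assocʳ y j i)))
      w³ : w ^ 3 ≈ (- ((x ^ 3) ^ k)) ^ k
      w³ = begin
        w ^ 3                    ≈⟨ swap (- (x ^ k)) k 3 ⟩
        ((- (x ^ k)) ^ 3) ^ k    ≈⟨ ^-congˡ k (-‿^-odd (x ^ k) 1) ⟩
        (- ((x ^ k) ^ 3)) ^ k    ≈⟨ ^-congˡ k (-‿cong (swap x k 3)) ⟩
        (- ((x ^ 3) ^ k)) ^ k    ∎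

    -- With U and W the values of T and P at q², this is E(q) = E(q²). The left-hand side is (P² +
    -- T²)² - 2 (T P)² = 4 W⁴ - 2 U⁴, and both 4 and -2 are 1 modulo 3.
    fourthPowers : ∀ {T P U W} → T * P ≈ U * U → P * P + T * T ≈ double (W * W) →
                   T ^ 4 + P ^ 4 ≈ U ^ 4 + W ^ 4
    fourthPowers {T} {P} {U} {W} TP≈U² P²+T²≈2W² = begin
      T ^ 4 + P ^ 4
        ≈⟨ solve 2 (λ t p → t :^ 4 :+ p :^ 4 :=
             (p :* p :+ t :* t) :* (p :* p :+ t :* t) :- (t :* p :* (t :* p) :+ t :* p :* (t :* p))) refl T P ⟩
      (P * P + T * T) * (P * P + T * T) - double (T * P * (T * P))
        ≈⟨ +-cong (*-cong P²+T²≈2W² P²+T²≈2W²) (-‿cong (double-cong (*-cong TP≈U² TP≈U²))) ⟩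
      double (W * W) * double (W * W) - double (U * U * (U * U))
        ≈⟨ solve 2 (λ u w → (w :* w :+ w :* w) :* (w :* w :+ w :* w) :- (u :* u :* (u :* u) :+ u :* u :* (u :* u)) :=
             u :^ 4 :+ w :^ 4 :+ (:1 :+ :1 :+ :1) :* (w :^ 4 :- u :^ 4)) refl U W ⟩
      U ^ 4 + W ^ 4 + (1# + 1# + 1#) * (W ^ 4 - U ^ 4)
        ≈⟨ +-triple _ _ ⟩
      U ^ 4 + W ^ 4 ∎

    module _ {T P U V A : Carrier} (TP≈U² : T * P ≈ U * U) where

      private
        step : ∀ {C u B} → T * u * A ≈ 1# → C * (T * u) ≈ B → B * A ≈ C
        step {C} {u} {B} TuA≈1 CTu≈B = begin
          B * A            ≈⟨ *-congʳ CTu≈B ⟨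
          C * (T * u) * A  ≈⟨ *-assoc C (T * u) A ⟩
          C * (T * u * A)  ≈⟨ *-congˡ TuA≈1 ⟩
          C * 1#           ≈⟨ *-identityʳ C ⟩
          C                ∎

      -- `V` stands for U^(9j), and 16, 12 and 8 are the possible values of c - 1 up to 9j. The
      -- number 18 is the least multiple of 9 exceeding all three by an even amount: the missing U²,
      -- U⁶ or U¹⁰ is then a power of T P, and removing one factor T from it leaves the value of the
      -- quotient.
      quotient₁₆ : T * (U ^ 16 * V) * A ≈ 1# → U ^ 18 * V * A ≈ P
      quotient₁₆ p = step p (begin
        P * (T * (U ^ 16 * V))   ≈⟨ solve 4 (λ t p u v → p :* (t :* (u :^ 16 :* v)) := t :* p :* (u :^ 16 :* v)) refl T P U V ⟩
        T * P * (U ^ 16 * V)     ≈⟨ *-congʳ TP≈U² ⟩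
        U * U * (U ^ 16 * V)     ≈⟨ solve 2 (λ u v → u :* u :* (u :^ 16 :* v) := u :^ 18 :* v) refl U V ⟩
        U ^ 18 * V               ∎)

      quotient₁₂ : T * (U ^ 12 * V) * A ≈ 1# → U ^ 18 * V * A ≈ P ^ 3 * (T * T)
      quotient₁₂ p = step p (begin
        P ^ 3 * (T * T) * (T * (U ^ 12 * V))
          ≈⟨ solve 4 (λ t p u v → p :^ 3 :* (t :* t) :* (t :* (u :^ 12 :* v)) := (t :* p) :^ 3 :* (u :^ 12 :* v)) refl T P U V ⟩
        (T * P) ^ 3 * (U ^ 12 * V)
          ≈⟨ *-congʳ (^-congˡ 3 TP≈U²) ⟩
        (U * U) ^ 3 * (U ^ 12 * V)
          ≈⟨ solve 2 (λ u v → (u :* u) :^ 3 :* (u :^ 12 :* v) := u :^ 18 :* v) refl U V ⟩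
        U ^ 18 * V ∎)

      quotient₈ : T ^ 4 + P ^ 4 ≈ 1# + 1# → T * (U ^ 8 * V) * A ≈ 1# →
                  U ^ 18 * V * A ≈ - (P ^ 3 * (P * P) + (P ^ 3) ^ 3)
      quotient₈ T⁴+P⁴≈2 p = trans (step p (begin
        T ^ 4 * P ^ 5 * (T * (U ^ 8 * V))
          ≈⟨ solve 4 (λ t p u v → t :^ 4 :* p :^ 5 :* (t :* (u :^ 8 :* v)) := (t :* p) :^ 5 :* (u :^ 8 :* v)) refl T P U V ⟩
        (T * P) ^ 5 * (U ^ 8 * V)
          ≈⟨ *-congʳ (^-congˡ 5 TP≈U²) ⟩
        (U * U) ^ 5 * (U ^ 8 * V)
          ≈⟨ solve 2 (λ u v → (u :* u) :^ 5 :* (u :^ 8 :* v) := u :^ 18 :* v) refl U V ⟩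
        U ^ 18 * V ∎)) (begin
        -- Counting exponents would fail for T⁴ P⁵ = T³ P³ (T P²): its three remaining single
        -- factors contribute three squares, and 1 + 1 + 4 = 6. Eliminating T⁴ leaves only P³ P² and
        -- P⁹.
        T ^ 4 * P ^ 5
          ≈⟨ solve 2 (λ t p → t :^ 4 :* p :^ 5 := (t :^ 4 :+ p :^ 4) :* p :^ 5 :- p :^ 9) refl T P ⟩
        (T ^ 4 + P ^ 4) * P ^ 5 - P ^ 9
          ≈⟨ +-congʳ (*-congʳ T⁴+P⁴≈2) ⟩
        (1# + 1#) * P ^ 5 - P ^ 9
          ≈⟨ solve 1 (λ p → (:1 :+ :1) :* p :^ 5 :- p :^ 9 :=
               :- (p :^ 3 :* (p :* p) :+ (p :^ 3) :^ 3) :+ (:1 :+ :1 :+ :1) :* p :^ 5) refl P ⟩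
        - (P ^ 3 * (P * P) + (P ^ 3) ^ 3) + (1# + 1# + 1#) * P ^ 5
          ≈⟨ +-triple _ _ ⟩
        - (P ^ 3 * (P * P) + (P ^ 3) ^ 3) ∎)

  -- Consequences in characteristic 4.

  module Characteristic4 (four≈0 : 1# + 1# + (1# + 1#) ≈ 0#) where

    +-quadruple : ∀ x y → x + (1# + 1# + (1# + 1#)) * y ≈ x
    +-quadruple x y = trans (+-congˡ (trans (*-congʳ four≈0) (zeroˡ y))) (+-identityʳ x)

    -- Every summand of theta but the constant one is doubled, and in characteristic 4 a product of
    -- two doubled elements is zero. This is what makes theta values their own inverses and their
    -- products additive up to the constant 1.
    θ-1+double : ∀ n x → ∃[ s ] θ n x ≈ 1# + double s
    θ-1+double zero    x = 0# , sym (trans (+-congˡ (+-identityʳ 0#)) (+-identityʳ 1#))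
    θ-1+double (suc n) x =
      let s , θ≈ = θ-1+double n x
          w      = (- (x ^ suc n)) ^ suc n
      in s + w , trans (+-congʳ θ≈)
           (solve 2 (λ s w → :1 :+ (s :+ s) :+ (w :+ w) := :1 :+ (s :+ w :+ (s :+ w))) refl s w)

    θ-square : ∀ n x → θ n x * θ n x ≈ 1#
    θ-square n x = let s , θ≈ = θ-1+double n x in begin
      θ n x * θ n x                                        ≈⟨ *-cong θ≈ θ≈ ⟩
      (1# + double s) * (1# + double s)                    ≈⟨ solve 1 (λ s →
        (:1 :+ (s :+ s)) :* (:1 :+ (s :+ s)) := :1 :+ (:1 :+ :1 :+ (:1 :+ :1)) :* (s :+ s :* s)) refl s ⟩
      1# + (1# + 1# + (1# + 1#)) * (s + s * s)             ≈⟨ +-quadruple 1# _ ⟩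
      1#                                                   ∎

    θ-product : ∀ n x y → θ n x * θ n y ≈ θ n x + θ n y - 1#
    θ-product n x y = let s , θx≈ = θ-1+double n x ; t , θy≈ = θ-1+double n y in begin
      θ n x * θ n y                                        ≈⟨ *-cong θx≈ θy≈ ⟩
      (1# + double s) * (1# + double t)                    ≈⟨ solve 2 (λ s t →
        (:1 :+ (s :+ s)) :* (:1 :+ (t :+ t)) :=
        :1 :+ (s :+ s) :+ (:1 :+ (t :+ t)) :- :1 :+ (:1 :+ :1 :+ (:1 :+ :1)) :* (s :* t)) refl s t ⟩
      1# + double s + (1# + double t) - 1# + (1# + 1# + (1# + 1#)) * (s * t)  ≈⟨ +-quadruple _ _ ⟩
      1# + double s + (1# + double t) - 1#                 ≈⟨ +-congʳ (+-cong θx≈ θy≈) ⟨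
      θ n x + θ n y - 1#                                   ∎

    θ-power : ∀ n x e → (θ n x ^ e ≈ 1#) ⊎ (θ n x ^ e ≈ θ n x)
    θ-power n x zero    = inj₁ refl
    θ-power n x (suc e) with θ-power n x e
    ... | inj₁ p = inj₂ (trans (*-congˡ p) (*-identityʳ _))
    ... | inj₂ p = inj₁ (trans (*-congˡ p) (θ-square n x))

    quotient : ∀ n x y e {A} → θ n x * θ n y ^ e * A ≈ 1# → (A ≈ θ n x) ⊎ (A ≈ θ n x + θ n y - 1#)
    quotient n x y e {A} TUA≈1 with θ-power n y e
    ... | inj₁ p = inj₁ (begin
      A                  ≈⟨ *-identityˡ A ⟨
      1# * A             ≈⟨ *-congʳ (θ-square n x) ⟨
      T * T * A          ≈⟨ solve 2 (λ t a → t :* t :* a := t :* (t :* :1 :* a)) refl T A ⟩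
      T * (T * 1# * A)   ≈⟨ *-congˡ (*-congʳ (*-congˡ (sym p))) ⟩
      T * (T * U ^ e * A) ≈⟨ *-congˡ TUA≈1 ⟩
      T * 1#             ≈⟨ *-identityʳ T ⟩
      T                  ∎)
      where T = θ n x ; U = θ n y
    ... | inj₂ p = inj₂ (begin
      A                  ≈⟨ solve 1 (λ a → a := :1 :* :1 :* a) refl A ⟩
      1# * 1# * A        ≈⟨ *-congʳ (*-cong (θ-square n x) (θ-square n y)) ⟨
      T * T * (U * U) * A  ≈⟨ solve 3 (λ t u a → t :* t :* (u :* u) :* a := t :* u :* (t :* u :* a)) refl T U A ⟩
      T * U * (T * U * A)  ≈⟨ *-congˡ (*-congʳ (*-congˡ (sym p))) ⟩
      T * U * (T * U ^ e * A) ≈⟨ *-congˡ TUA≈1 ⟩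
      T * U * 1#         ≈⟨ *-identityʳ (T * U) ⟩
      T * U              ≈⟨ θ-product n x y ⟩
      T + U - 1#         ∎)
      where T = θ n x ; U = θ n y

  -- The eta quotient of the generating function.

  -- Here c = d + 2, so that c - 1 is `suc d` and 2c - 3 is `suc (2 * d)`. Of the 2d + 2 factors F₂
  -- obtained from (F₄ U)^(d+1), one joins T to form F₁².
  eta-quotient : ∀ {F₁ F₂ F₄ T U} d → F₁ * F₁ ≈ F₂ * T → F₂ * F₂ ≈ F₄ * U →
                 T * U ^ suc d * F₄ ^ suc d ≈ F₁ ^ 2 * F₂ ^ suc (2 ℕ.* d)
  eta-quotient {F₁} {F₂} {F₄} {T} {U} d F₁²≈ F₂²≈ = begin
    T * U ^ suc d * F₄ ^ suc d
      ≈⟨ solve 3 (λ t u f → t :* u :* f := t :* (f :* u)) refl T (U ^ suc d) (F₄ ^ suc d) ⟩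
    T * (F₄ ^ suc d * U ^ suc d)
      ≈⟨ *-congˡ (sym (^-distrib-* F₄ U (suc d))) ⟩
    T * (F₄ * U) ^ suc d
      ≈⟨ *-congˡ (^-congˡ (suc d) (trans (sym F₂²≈) (*-congˡ (sym (*-identityʳ F₂))))) ⟩
    T * (F₂ ^ 2) ^ suc d
      ≈⟨ *-congˡ (^-assocʳ F₂ 2 (suc d)) ⟩
    T * F₂ ^ (2 ℕ.* suc d)
      ≈⟨ *-congˡ (^-congʳ F₂ (ℕ.*-suc 2 d)) ⟩
    T * (F₂ * F₂ ^ suc (2 ℕ.* d))
      ≈⟨ solve 3 (λ t f g → t :* (f :* g) := f :* t :* g) refl T F₂ _ ⟩
    F₂ * T * F₂ ^ suc (2 ℕ.* d)
      ≈⟨ *-congʳ (trans (sym F₁²≈) (*-congˡ (sym (*-identityʳ F₁)))) ⟩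
    F₁ ^ 2 * F₂ ^ suc (2 ℕ.* d) ∎

  -- The hypotheses are the even and the odd part of a² - b² = (a′ - b′)².

  sum-of-squares : ∀ {a b a′ b′} →
    a * a - (a′ * a′ + b′ * b′) ≈ 0# → b * b - double (a′ * b′) ≈ 0# →
    (a + b) * (a + b) + (a - b) * (a - b) ≈ double ((a′ + b′) * (a′ + b′))
  sum-of-squares {a} {b} {a′} {b′} p q = begin
    (a + b) * (a + b) + (a - b) * (a - b)
      ≈⟨ solve 4 (λ a b c d → (a :+ b) :* (a :+ b) :+ (a :- b) :* (a :- b) :=
           ((c :+ d) :* (c :+ d) :+ (c :+ d) :* (c :+ d)) :+
           (a :* a :- (c :* c :+ d :* d) :+ (b :* b :- (c :* d :+ c :* d)) :+ (a :* a :- (c :* c :+ d :* d) :+ (b :* b :- (c :* d :+ c :* d)))))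
           refl a b a′ b′ ⟩
    double ((a′ + b′) * (a′ + b′)) + double (a * a - (a′ * a′ + b′ * b′) + (b * b - double (a′ * b′)))
      ≈⟨ +-congˡ (double-cong (trans (+-cong p q) (+-identityʳ 0#))) ⟩
    double ((a′ + b′) * (a′ + b′)) + double 0#
      ≈⟨ trans (+-congˡ (+-identityʳ 0#)) (+-identityʳ _) ⟩
    double ((a′ + b′) * (a′ + b′)) ∎

open import Defs hiding (_^_)
import Defs
open import Relation.Binary.PropositionalEquality hiding (setoid)
open +-*-Solver using () renaming (solve to solveℕ; _:+_ to _:+ℕ_; _:*_ to _:*ℕ_; _:=_ to _:=ℕ_; con to conℕ)

-- The ring of integer series modulo `m` and q^N.

infixl 6 _⊕_
infix 4 _≈[_,_]_

_⊕_ : Series → Series → Series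
(A ⊕ B) n = A n ℤ.+ B n

⊝_ : Series → Series
(⊝ A) n = ℤ.- A n

const : ℤ → Series
const z zero    = z
const z (suc n) = 0ℤ

tail : Series → Series
tail A n = A (suc n)

scale : ℤ → Series → Series
scale z A n = z ℤ.* A n

⊛-cong : ∀ {A A′ B B′} → A ≗ A′ → B ≗ B′ → A ⊛ B ≗ A′ ⊛ B′
⊛-cong A≗ B≗ n = sum-cong-≗ {suc n} λ i → cong₂ ℤ._*_ (A≗ (toℕ i)) (B≗ (n ∸ toℕ i))

⊛-distribʳ : ∀ A B C → (B ⊕ C) ⊛ A ≗ B ⊛ A ⊕ C ⊛ A
⊛-distribʳ A B C n = trans
  (sum-cong-≗ {suc n} λ i → ℤ.*-distribʳ-+ (A (n ∸ toℕ i)) (B (toℕ i)) (C (toℕ i)))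
  (∑-distrib-+ {suc n} (λ i → B (toℕ i) ℤ.* A (n ∸ toℕ i)) (λ i → C (toℕ i) ℤ.* A (n ∸ toℕ i)))

⊛-scaleˡ : ∀ z A B → scale z A ⊛ B ≗ scale z (A ⊛ B)
⊛-scaleˡ z A B n = trans
  (sum-cong-≗ {suc n} λ i → ℤ.*-assoc z (A (toℕ i)) (B (n ∸ toℕ i)))
  (sym (*-distribˡ-sum {suc n} z (λ i → A (toℕ i) ℤ.* B (n ∸ toℕ i))))

-- The convolution unfolds only on its left factor. Commuting, unfolding the other factor and
-- commuting again peels off both leading coefficients, which leaves `tail A` and `tail B`, a
-- symmetric situation at a smaller index.
⊛-comm : ∀ A B → A ⊛ B ≗ B ⊛ A
⊛-comm A B zero    = cong (ℤ._+ 0ℤ) (ℤ.*-comm (A 0) (B 0))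
⊛-comm A B (suc n) = trans (cong (λ w → A 0 ℤ.* B (suc n) ℤ.+ w) (⊛-comm (tail A) B n)) (lemma n)
  where
  lemma : ∀ n → A 0 ℤ.* B (suc n) ℤ.+ (B ⊛ tail A) n ≡ (B ⊛ A) (suc n)
  lemma zero    = solve 4 (λ a a′ b b′ → a :* b′ :+ (b :* a′ :+ con 0ℤ) := b :* a′ :+ (b′ :* a :+ con 0ℤ))
    refl (A 0) (A 1) (B 0) (B 1)
    where open ℤ.+-*-Solver
  lemma (suc n) = begin
    A 0 ℤ.* B (2 ℕ.+ n) ℤ.+ (B 0 ℤ.* A (2 ℕ.+ n) ℤ.+ (tail B ⊛ tail A) n)
      ≡⟨ cong (λ z → A 0 ℤ.* B (2 ℕ.+ n) ℤ.+ (B 0 ℤ.* A (2 ℕ.+ n) ℤ.+ z)) (⊛-comm (tail B) (tail A) n) ⟩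
    A 0 ℤ.* B (2 ℕ.+ n) ℤ.+ (B 0 ℤ.* A (2 ℕ.+ n) ℤ.+ (tail A ⊛ tail B) n)
      ≡⟨ solve 3 (λ x y z → x :+ (y :+ z) := y :+ (x :+ z)) refl
           (A 0 ℤ.* B (2 ℕ.+ n)) (B 0 ℤ.* A (2 ℕ.+ n)) ((tail A ⊛ tail B) n) ⟩
    B 0 ℤ.* A (2 ℕ.+ n) ℤ.+ (A ⊛ tail B) (suc n)
      ≡⟨ cong (λ w → B 0 ℤ.* A (2 ℕ.+ n) ℤ.+ w) (⊛-comm A (tail B) (suc n)) ⟩
    (B ⊛ A) (2 ℕ.+ n) ∎
    where
    open ℤ.+-*-Solver
    open ≡-Reasoning

⊛-distribˡ : ∀ A B C → A ⊛ (B ⊕ C) ≗ A ⊛ B ⊕ A ⊛ C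
⊛-distribˡ A B C n = trans (⊛-comm A (B ⊕ C) n) (trans (⊛-distribʳ A B C n)
    (cong₂ ℤ._+_ (⊛-comm B A n) (⊛-comm C A n)))

⊛-assoc : ∀ A B C → (A ⊛ B) ⊛ C ≗ A ⊛ (B ⊛ C)
⊛-assoc A B C zero = solve 3 (λ a b c →
    (a :* b :+ con 0ℤ) :* c :+ con 0ℤ := a :* (b :* c :+ con 0ℤ) :+ con 0ℤ)
    refl (A 0) (B 0) (C 0)
  where open ℤ.+-*-Solver
⊛-assoc A B C (suc n) = begin
  (A ⊛ B) 0 ℤ.* C (suc n) ℤ.+ ((scale (A 0) (tail B) ⊕ tail A ⊛ B) ⊛ C) n
    ≡⟨ cong (λ w → (A ⊛ B) 0 ℤ.* C (suc n) ℤ.+ w) (⊛-distribʳ C (scale (A 0) (tail B)) (tail A ⊛ B) n) ⟩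
  (A ⊛ B) 0 ℤ.* C (suc n) ℤ.+ ((scale (A 0) (tail B) ⊛ C) n ℤ.+ ((tail A ⊛ B) ⊛ C) n)
    ≡⟨ cong₂ (λ y z → (A ⊛ B) 0 ℤ.* C (suc n) ℤ.+ (y ℤ.+ z))
         (⊛-scaleˡ (A 0) (tail B) C n) (⊛-assoc (tail A) B C n) ⟩
  (A ⊛ B) 0 ℤ.* C (suc n) ℤ.+ (A 0 ℤ.* (tail B ⊛ C) n ℤ.+ (tail A ⊛ (B ⊛ C)) n)
    ≡⟨ solve 5 (λ a b c d e → (a :* b :+ con 0ℤ) :* c :+ (a :* d :+ e) := a :* (b :* c :+ d) :+ e)
         refl (A 0) (B 0) (C (suc n)) ((tail B ⊛ C) n) ((tail A ⊛ (B ⊛ C)) n) ⟩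
  A 0 ℤ.* (B ⊛ C) (suc n) ℤ.+ (tail A ⊛ (B ⊛ C)) n ∎
  where
  open ℤ.+-*-Solver
  open ≡-Reasoning

⊛-zeroˡ : ∀ A B → A ≗ const 0ℤ → ∀ n → (A ⊛ B) n ≡ 0ℤ
⊛-zeroˡ A B A≗0 zero    = cong (λ z → z ℤ.* B 0 ℤ.+ 0ℤ) (A≗0 0)
⊛-zeroˡ A B A≗0 (suc n) = cong₂ (λ y z → y ℤ.* B (suc n) ℤ.+ z)
  (A≗0 0) (⊛-zeroˡ (tail A) B tailA≗0 n)
  where
  tailA≗0 : tail A ≗ const 0ℤ
  tailA≗0 zero    = A≗0 1
  tailA≗0 (suc n) = A≗0 (2 ℕ.+ n)

⊛-constˡ : ∀ z A → const z ⊛ A ≗ scale z A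
⊛-constˡ z A zero    = ℤ.+-identityʳ (z ℤ.* A 0)
⊛-constˡ z A (suc n) = trans
  (cong (λ w → z ℤ.* A (suc n) ℤ.+ w) (⊛-zeroˡ (tail (const z)) A (λ { zero → refl ; (suc _) → refl }) n))
  (ℤ.+-identityʳ _)

one≗const : one ≗ const 1ℤ
one≗const zero    = refl
one≗const (suc n) = refl

⊛-identityˡ : ∀ A → one ⊛ A ≗ A
⊛-identityˡ A n = begin
  (one ⊛ A) n        ≡⟨ ⊛-cong {one} {const 1ℤ} {A} one≗const (λ _ → refl) n ⟩
  (const 1ℤ ⊛ A) n   ≡⟨ ⊛-constˡ 1ℤ A n ⟩
  1ℤ ℤ.* A n         ≡⟨ ℤ.*-identityˡ (A n) ⟩
  A n                ∎
  where open ≡-Reasoning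

-- Equality in (ℤ/m)[q]/(q^N), imposed on integer series rather than on a quotient type, so that
-- `f k` and `ā c` are themselves elements of the ring.
record _≈[_,_]_ (A : Series) (m N : ℕ) (B : Series) : Set where
  constructor mk
  field coeff : ∀ n → n < N → + m ∣ᶻ A n ℤ.- B n

open _≈[_,_]_ public

module _ {m N : ℕ} where

  ≗⇒≈ : ∀ {A B} → A ≗ B → A ≈[ m , N ] B
  ≗⇒≈ {A} {B} A≗B = mk λ n _ → divides 0ℤ (ℤ.i≡j⇒i-j≡0 (A≗B n))

  ⊕-cong : ∀ {A A′ B B′} → A ≈[ m , N ] A′ → B ≈[ m , N ] B′ → A ⊕ B ≈[ m , N ] A′ ⊕ B′
  ⊕-cong {A} {A′} {B} {B′} p q = mk λ n n<N → subst (+ m ∣ᶻ_)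
    (solve 4 (λ a a′ b b′ → (a :- a′) :+ (b :- b′) := (a :+ b) :- (a′ :+ b′)) refl (A n) (A′ n) (B n) (B′ n))
    (ℤ∣.∣m∣n⇒∣m+n (coeff p n n<N) (coeff q n n<N))
    where open ℤ.+-*-Solver

  ⊝-cong : ∀ {A B} → A ≈[ m , N ] B → ⊝ A ≈[ m , N ] ⊝ B
  ⊝-cong {A} {B} p = mk λ n n<N → subst (+ m ∣ᶻ_)
    (ℤ.neg-distrib-+ (A n) (ℤ.- B n)) (ℤ∣.∣m⇒∣-m (coeff p n n<N))

  private
    ∣-mul : ∀ {a a′ b b′} → + m ∣ᶻ a ℤ.- a′ → + m ∣ᶻ b ℤ.- b′ → + m ∣ᶻ a ℤ.* b ℤ.- a′ ℤ.* b′
    ∣-mul {a} {a′} {b} {b′} p q = subst (+ m ∣ᶻ_)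
      (solve 4 (λ a a′ b b′ → (a :- a′) :* b :+ a′ :* (b :- b′) := a :* b :- a′ :* b′) refl a a′ b b′)
      (ℤ∣.∣m∣n⇒∣m+n (ℤ∣.∣m⇒∣m*n b p) (ℤ∣.∣n⇒∣m*n a′ q))
      where open ℤ.+-*-Solver

    ∣-sum : ∀ n (s t : Fin n → ℤ) → (∀ i → + m ∣ᶻ s i ℤ.- t i) →
            + m ∣ᶻ (∑[ i < n ] s i) ℤ.- (∑[ i < n ] t i)
    ∣-sum zero    s t p = divides 0ℤ refl
    ∣-sum (suc n) s t p = subst (+ m ∣ᶻ_)
      (solve 4 (λ a a′ b b′ → (a :- a′) :+ (b :- b′) := (a :+ b) :- (a′ :+ b′)) refl
        (s zero) (t zero) (∑[ i < n ] s (suc i)) (∑[ i < n ] t (suc i)))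
      (ℤ∣.∣m∣n⇒∣m+n (p zero) (∣-sum n (λ i → s (suc i)) (λ i → t (suc i)) (λ i → p (suc i))))
      where open ℤ.+-*-Solver

  ⊛-cong-≈ : ∀ {A A′ B B′} → A ≈[ m , N ] A′ → B ≈[ m , N ] B′ → A ⊛ B ≈[ m , N ] A′ ⊛ B′
  ⊛-cong-≈ {A} {A′} {B} {B′} p q = mk λ n n<N → ∣-sum (suc n)
    (λ i → A (toℕ i) ℤ.* B (n ∸ toℕ i)) (λ i → A′ (toℕ i) ℤ.* B′ (n ∸ toℕ i)) λ i →
    ∣-mul {A (toℕ i)} {A′ (toℕ i)} {B (n ∸ toℕ i)} {B′ (n ∸ toℕ i)}
      (coeff p (toℕ i) (ℕ.≤-<-trans (ℕ.≤-pred (toℕ<n i)) n<N))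
      (coeff q (n ∸ toℕ i) (ℕ.≤-<-trans (ℕ.m∸n≤m n (toℕ i)) n<N))
    where open import Data.Fin.Properties using (toℕ<n)

  ≈-sym : ∀ {A B} → A ≈[ m , N ] B → B ≈[ m , N ] A
  ≈-sym {A} {B} p = mk λ n n<N → subst (+ m ∣ᶻ_)
    (solve 2 (λ a b → :- (a :- b) := b :- a) refl (A n) (B n)) (ℤ∣.∣m⇒∣-m (coeff p n n<N))
    where open ℤ.+-*-Solver

  ≈-trans : ∀ {A B C} → A ≈[ m , N ] B → B ≈[ m , N ] C → A ≈[ m , N ] C
  ≈-trans {A} {B} {C} p q = mk λ n n<N → subst (+ m ∣ᶻ_)
    (solve 3 (λ a b c → (a :- b) :+ (b :- c) := a :- c) refl (A n) (B n) (C n))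
    (ℤ∣.∣m∣n⇒∣m+n (coeff p n n<N) (coeff q n n<N))
    where open ℤ.+-*-Solver

truncatedRing : ℕ → ℕ → CommutativeRing _ _
truncatedRing m N = record
  { Carrier = Series ; _≈_ = _≈[ m , N ]_ ; _+_ = _⊕_ ; _*_ = _⊛_ ; -_ = ⊝_ ; 0# = const 0ℤ ; 1# = one
  ; isCommutativeRing = record
    { isRing = record
      { +-isAbelianGroup = record
        { isGroup = record
          { isMonoid = record
            { isSemigroup = record
              { isMagma = record
                { isEquivalence = record { refl = ≗⇒≈ λ _ → refl ; sym = ≈-sym ; trans = ≈-trans }
                ; ∙-cong = ⊕-cong }
              ; assoc = λ A B C → ≗⇒≈ λ n → ℤ.+-assoc (A n) (B n) (C n) }
            ; identity = (λ A → ≗⇒≈ λ n → trans (cong (ℤ._+ A n) (0-coeff n)) (ℤ.+-identityˡ (A n)))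
                       , (λ A → ≗⇒≈ λ n → trans (cong (λ w → A n ℤ.+ w) (0-coeff n)) (ℤ.+-identityʳ (A n))) }
          ; inverse = (λ A → ≗⇒≈ λ n → trans (ℤ.+-inverseˡ (A n)) (sym (0-coeff n)))
                    , (λ A → ≗⇒≈ λ n → trans (ℤ.+-inverseʳ (A n)) (sym (0-coeff n)))
          ; ⁻¹-cong = ⊝-cong }
        ; comm = λ A B → ≗⇒≈ λ n → ℤ.+-comm (A n) (B n) }
      ; *-cong = ⊛-cong-≈
      ; *-assoc = λ A B C → ≗⇒≈ (⊛-assoc A B C)
      ; *-identity = (λ A → ≗⇒≈ (⊛-identityˡ A))
                   , (λ A → ≗⇒≈ λ n → trans (⊛-comm A one n) (⊛-identityˡ A n))
      ; distrib = (λ A B C → ≗⇒≈ (⊛-distribˡ A B C)) , (λ A B C → ≗⇒≈ (⊛-distribʳ A B C)) }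
    ; *-comm = λ A B → ≗⇒≈ (⊛-comm A B) } }
  where
  0-coeff : ∀ n → const 0ℤ n ≡ 0ℤ
  0-coeff zero    = refl
  0-coeff (suc n) = refl

-- Supports of series and residues of exponents modulo 9.

-- The coefficients outside `Q` vanish in ℤ, not merely modulo `m`. Hence this property does not
-- pass along congruences of series.
Supp : (ℕ → Set) → Series → Set
Supp Q A = ∀ n → ¬ Q n → A n ≡ 0ℤ

supp-⊆ : ∀ {Q Q′ A} → (∀ n → Q n → Q′ n) → Supp Q A → Supp Q′ A
supp-⊆ Q⊆Q′ suppA n ¬Q′ = suppA n λ Qn → ¬Q′ (Q⊆Q′ n Qn)

supp-⊕ : ∀ {Q A B} → Supp Q A → Supp Q B → Supp Q (A ⊕ B)
supp-⊕ suppA suppB n ¬Q = cong₂ ℤ._+_ (suppA n ¬Q) (suppB n ¬Q)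

supp-⊝ : ∀ {Q A} → Supp Q A → Supp Q (⊝ A)
supp-⊝ suppA n ¬Q = cong ℤ.-_ (suppA n ¬Q)

supp-q^ : ∀ a → Supp (_≡ a) (q^ a)
supp-q^ a n n≢a rewrite dec-false (n ℕ.≟ a) n≢a = refl

supp-0 : ∀ {Q} → Supp Q (const 0ℤ)
supp-0 zero    _ = refl
supp-0 (suc n) _ = refl

supp-one : ∀ {Q : ℕ → Set} → Q 0 → Supp Q one
supp-one Q0 = supp-⊆ (λ { n refl → Q0 }) (supp-q^ 0)

supp-⊛ : ∀ {Q Q′ Q″ : ℕ → Set} {A B} → Decidable Q → Decidable Q′ → (∀ i j → Q i → Q′ j → Q″ (i ℕ.+ j)) →
         Supp Q A → Supp Q′ B → Supp Q″ (A ⊛ B)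
supp-⊛ {Q} {Q′} {Q″} {A} {B} Q? Q′? Q+Q′⊆Q″ suppA suppB n ¬Q″ =
  trans (sum-cong-≗ {suc n} term) (sum-replicate-zero (suc n))
  where
  term : ∀ (i : Fin (suc n)) → A (toℕ i) ℤ.* B (n ∸ toℕ i) ≡ 0ℤ
  term i with Q? (toℕ i) | Q′? (n ∸ toℕ i)
  ... | no ¬Q | _      = cong (ℤ._* B (n ∸ toℕ i)) (suppA (toℕ i) ¬Q)
  ... | yes _ | no ¬Q′ = trans (cong (A (toℕ i) ℤ.*_) (suppB (n ∸ toℕ i) ¬Q′)) (ℤ.*-zeroʳ (A (toℕ i)))
  ... | yes Qi | yes Q′j = ⊥-elim (¬Q″ (subst Q″ (ℕ.m+[n∸m]≡n (ℕ.≤-pred (toℕ<n i))) (Q+Q′⊆Q″ _ _ Qi Q′j)))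

supp-⊛-≡ : ∀ {a b A B} → Supp (_≡ a) A → Supp (_≡ b) B → Supp (_≡ a ℕ.+ b) (A ⊛ B)
supp-⊛-≡ {a} {b} = supp-⊛ (ℕ._≟ a) (ℕ._≟ b) λ { _ _ refl refl → refl }

q^-+ : ∀ a b → q^ a ⊛ q^ b ≗ q^ (a ℕ.+ b)
q^-+ zero    b n       = ⊛-identityˡ (q^ b) n
q^-+ (suc a) b zero    = refl
q^-+ (suc a) b (suc n) = trans (ℤ.+-identityˡ _) (q^-+ a b n)

Residue : List ℕ → ℕ → Set
Residue l n = n % 9 ∈ l

residue? : ∀ l → Decidable (Residue l)
residue? l n = n % 9 ∈? l

sumsIn? : ∀ l l′ l″ →
  Dec (∀ (i j : Fin 9) → toℕ i ∈ l → toℕ j ∈ l′ → (toℕ i ℕ.+ toℕ j) % 9 ∈ l″)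
sumsIn? l l′ l″ = all? λ i → all? λ j → (toℕ i ∈? l) →-dec (toℕ j ∈? l′) →-dec ((toℕ i ℕ.+ toℕ j) % 9 ∈? l″)

residue-+ : ∀ {l l′ l″} {_ : True (sumsIn? l l′ l″)} →
  ∀ i j → Residue l i → Residue l′ j → Residue l″ (i ℕ.+ j)
residue-+ {l} {l′} {l″} {table} i j i∈ j∈ = subst (_∈ l″)
  (trans (cong₂ (λ x y → (x ℕ.+ y) % 9) i≡ j≡) (sym (%-distribˡ-+ i j 9)))
  (toWitness table (fromℕ< (m%n<n i 9)) (fromℕ< (m%n<n j 9)) (subst (_∈ l) (sym i≡) i∈) (subst (_∈ l′) (sym j≡) j∈))
  where
  i≡ = toℕ-fromℕ< (m%n<n i 9)
  j≡ = toℕ-fromℕ< (m%n<n j 9)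

squaresIn? : ∀ a l → Dec (∀ (i : Fin 9) → (toℕ i ℕ.* toℕ i % 9) ℕ.* (a % 9) % 9 ∈ l)
squaresIn? a l = all? λ i → (toℕ i ℕ.* toℕ i % 9) ℕ.* (a % 9) % 9 ∈? l

residue-square : ∀ {l} a {_ : True (squaresIn? a l)} → ∀ k → Residue l (k ℕ.* (k ℕ.* a))
residue-square {l} a {table} k = subst (_∈ l) (begin
    (toℕ i ℕ.* toℕ i % 9) ℕ.* (a % 9) % 9      ≡⟨ cong (λ x → (x ℕ.* x % 9) ℕ.* (a % 9) % 9) (toℕ-fromℕ< (m%n<n k 9)) ⟩
    ((k % 9) ℕ.* (k % 9) % 9) ℕ.* (a % 9) % 9  ≡⟨ cong (λ x → x ℕ.* (a % 9) % 9) (%-distribˡ-* k k 9) ⟨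
    (k ℕ.* k % 9) ℕ.* (a % 9) % 9              ≡⟨ %-distribˡ-* (k ℕ.* k) a 9 ⟨
    k ℕ.* k ℕ.* a % 9                          ≡⟨ cong (_% 9) (ℕ.*-assoc k k a) ⟩
    k ℕ.* (k ℕ.* a) % 9                        ∎)
  (toWitness table i)
  where
  open ≡-Reasoning
  i = fromℕ< (m%n<n k 9)

-- Since -1 is not a square modulo 3, a sum of two squares divisible by 3 is divisible by 9; this
-- excludes 3 and 6 from `sumsOfTwoSquares`. Adding 0 or 3 to such a sum therefore never gives 6.
not6 squares sumsOfTwoSquares : List ℕ
not6             = 0 ∷ 1 ∷ 2 ∷ 3 ∷ 4 ∷ 5 ∷ 7 ∷ 8 ∷ []
squares          = 0 ∷ 1 ∷ 4 ∷ 7 ∷ []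
sumsOfTwoSquares = 0 ∷ 1 ∷ 2 ∷ 4 ∷ 5 ∷ 7 ∷ 8 ∷ []

supp-residue-⊛ : ∀ {l l′ l″ A B} {_ : True (sumsIn? l l′ l″)} →
  Supp (Residue l) A → Supp (Residue l′) B → Supp (Residue l″) (A ⊛ B)
supp-residue-⊛ {l} {l′} {l″} {_} {_} {table} = supp-⊛ (residue? l) (residue? l′) (residue-+ {l} {l′} {l″} {table})

const-⊛ : ∀ a b → const (a ℤ.* b) ≗ const a ⊛ const b
const-⊛ a b zero    = sym (ℤ.+-identityʳ (a ℤ.* b))
const-⊛ a b (suc n) = sym (trans (⊛-constˡ a (const b) (suc n)) (ℤ.*-zeroʳ a))

constHomomorphism : ∀ m N → ℤ.+-*-rawRing -Raw-AlmostCommutative⟶ fromCommutativeRing (truncatedRing m N)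
constHomomorphism m N = record
  { ⟦_⟧ = const
  ; +-homo = λ a b → ≗⇒≈ λ { zero → refl ; (suc n) → refl }
  ; *-homo = λ a b → ≗⇒≈ (const-⊛ a b)
  ; -‿homo = λ a → ≗⇒≈ λ { zero → refl ; (suc n) → refl }
  ; 0-homo = ≗⇒≈ λ _ → refl
  ; 1-homo = ≗⇒≈ λ n → sym (one≗const n)
  }

∣-sum : ∀ {d} n (t : Fin n → ℤ) → (∀ i → d ∣ᶻ t i) → d ∣ᶻ (∑[ i < n ] t i)
∣-sum zero    t p = divides 0ℤ refl
∣-sum (suc n) t p = ℤ∣.∣m∣n⇒∣m+n (p zero) (∣-sum n (λ i → t (suc i)) (λ i → p (suc i)))

-- Theta series and products as truncated series.

module Truncated (m N : ℕ) where

  open CommutativeRing (truncatedRing m N)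
    renaming (refl to ≈-refl; sym to ≈sym; trans to ≈trans; zero to *-zero)
  open import Algebra.Properties.Semiring.Exp semiring
  open Theta (truncatedRing m N) (constHomomorphism m N) public

  -- The common length of all products and theta sums. It is written `N * 2` because `θ-negate` and
  -- `θ-split` work at even lengths.
  L : ℕ
  L = N ℕ.* 2

  N≤L : N ≤ L
  N≤L = ℕ.m≤m*n N 2

  ∣⇒≈0 : ∀ {A} → (∀ n → n < N → + m ∣ᶻ A n) → A ≈ 0#
  ∣⇒≈0 {A} m∣A = mk λ n n<N → subst (+ m ∣ᶻ_)
    (sym (trans (cong (λ w → A n ℤ.- w) (supp-0 {λ _ → ⊥} n λ ())) (ℤ.+-identityʳ (A n)))) (m∣A n n<N)

  ≈⇒∣ : ∀ {A B} → A ≈ B → ∀ n → n < N → B n ≡ 0ℤ → + m ∣ᶻ A n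
  ≈⇒∣ {A} {B} A≈B n n<N Bn≡0 = subst (+ m ∣ᶻ_)
    (trans (cong (λ b → A n ℤ.- b) Bn≡0) (ℤ.+-identityʳ (A n))) (coeff A≈B n n<N)

  supp-≈0 : ∀ {a A} → N ≤ a → Supp (_≡ a) A → A ≈ 0#
  supp-≈0 N≤a suppA = ∣⇒≈0 λ n n<N → subst (+ m ∣ᶻ_)
    (sym (suppA n (ℕ.<⇒≢ (ℕ.<-≤-trans n<N N≤a)))) (divides 0ℤ refl)

  supp-^ : ∀ {a A} n → Supp (_≡ a) A → Supp (_≡ n ℕ.* a) (A ^ n)
  supp-^ zero    suppA = supp-q^ 0
  supp-^ (suc n) suppA = supp-⊛-≡ suppA (supp-^ n suppA)

  supp-^-⊆ : ∀ {Q : ℕ → Set} {A} → Decidable Q → Q 0 → (∀ i j → Q i → Q j → Q (i ℕ.+ j)) → ∀ n → Supp Q A → Supp Q (A ^ n)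
  supp-^-⊆ Q? Q0 Q+ zero    suppA = supp-one Q0
  supp-^-⊆ Q? Q0 Q+ (suc n) suppA = supp-⊛ Q? Q? Q+ suppA (supp-^-⊆ Q? Q0 Q+ n suppA)

  θ-term : ∀ {a x} k → Supp (_≡ a) x → Supp (_≡ k ℕ.* (k ℕ.* a)) ((- (x ^ k)) ^ k)
  θ-term k suppx = supp-^ k (supp-⊝ (supp-^ k suppx))

  supp-at : ∀ {Q : ℕ → Set} {a A} → Q a → Supp (_≡ a) A → Supp Q A
  supp-at Qa = supp-⊆ λ { _ refl → Qa }

  supp-θ : ∀ {Q : ℕ → Set} {a x} n → (∀ k → Q (k ℕ.* (k ℕ.* a))) → Supp (_≡ a) x → Supp Q (θ n x)
  supp-θ zero    Qsq suppx = supp-one (Qsq 0)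
  supp-θ (suc n) Qsq suppx = supp-⊕ (supp-θ n Qsq suppx) (supp-⊕ term term)
    where term = supp-at (Qsq (suc n)) (θ-term (suc n) suppx)

  θ-constant : ∀ {a x} n → Supp (_≡ suc a) x → θ n x 0 ≡ 1ℤ
  θ-constant zero    suppx = refl
  θ-constant {a} {x} (suc n) suppx = cong₂ (λ s w → s ℤ.+ (w ℤ.+ w)) (θ-constant n suppx)
    (θ-term (suc n) suppx 0 λ ())

  ^-constant : ∀ {A} n → A 0 ≡ 1ℤ → (A ^ n) 0 ≡ 1ℤ
  ^-constant zero    A0≡1 = refl
  ^-constant (suc n) A0≡1 = cong₂ (λ x y → x ℤ.* y ℤ.+ 0ℤ) A0≡1 (^-constant n A0≡1)

  ^≡ : ∀ A n → A Defs.^ n ≡ A ^ n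
  ^≡ A zero    = refl
  ^≡ A (suc n) = cong (A ⊛_) (^≡ A n)

  q^-^ : ∀ {x} k → x ≈ q^ k → ∀ n → x ^ n ≈ q^ (k ℕ.* n)
  q^-^ k x≈q zero    = ≗⇒≈ λ n → cong (λ e → (q^ e) n) (sym (ℕ.*-zeroʳ k))
  q^-^ k x≈q (suc n) = ≈trans (*-cong x≈q (q^-^ k x≈q n)) (≗⇒≈ λ i →
    trans (q^-+ k (k ℕ.* n) i) (cong (λ e → (q^ e) i) (sym (ℕ.*-suc k n))))

  ∏⁻≈partialProduct : ∀ {x} k → x ≈ q^ k → ∀ n → ∏⁻ n x ≈ partialProduct k n
  ∏⁻≈partialProduct k x≈q zero    = ≈-refl
  ∏⁻≈partialProduct k x≈q (suc n) =
    *-cong (+-congˡ {1#} (-‿cong (q^-^ k x≈q (suc n)))) (∏⁻≈partialProduct k x≈q n)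

  ∏⁻≈f : ∀ {x} k .{{_ : NonZero k}} → x ≈ q^ k → ∏⁻ L x ≈ f k
  ∏⁻≈f k x≈q = ≈trans (∏⁻≈partialProduct k x≈q L) (mk λ n n<N → divides 0ℤ (ℤ.i≡j⇒i-j≡0
    (trans (cong (λ l → partialProduct k l n) (sym (ℕ.m∸n+n≡m (ℕ.<⇒≤ (ℕ.<-≤-trans n<N N≤L)))))
           (f-limit k n (L ∸ n)))))

  f-inverse : ∀ k .{{_ : NonZero k}} → f k * inv (f k) ≈ 1#
  f-inverse k = ≗⇒≈ (inv-inverse (f k) refl)

  ∏⁻-unit : ∀ {x} k .{{_ : NonZero k}} → x ≈ q^ k → ∏⁻ L x * inv (f k) ≈ 1#
  ∏⁻-unit k x≈q = ≈trans (*-congʳ (∏⁻≈f k x≈q)) (f-inverse k)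

  doubled : ∀ {x} a → x ≈ q^ a → x * x ≈ q^ (a ℕ.+ a)
  doubled a x≈q = ≈trans (*-cong x≈q x≈q) (≗⇒≈ (q^-+ a a))

  -- A general exponent `a` is kept because E is later followed along q, q², q⁴ and so on.
  θθ⁻ : ∀ a .{{_ : NonZero a}} → θ L (q^ a) * θ L (- q^ a) ≈ θ L (q^ a * q^ a) * θ L (q^ a * q^ a)
  θθ⁻ a@(suc _) = θ-negate N (q^ a)
    (supp-≈0 (ℕ.≤-trans (ℕ.n≤1+n N) (ℕ.m≤m*n (suc N) a)) (supp-^ (suc N) (supp-q^ a)))
    (∏⁻-unit (a ℕ.+ a) x²) (∏⁻-unit (a ℕ.+ a ℕ.+ (a ℕ.+ a)) (doubled (a ℕ.+ a) x²))
    where x² = doubled a ≈-refl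

  disjoint : ∀ {Q Q′ : ℕ → Set} {A B} → Decidable Q → (∀ n → Q n → ¬ Q′ n) →
             Supp Q A → Supp Q′ B → A ≈ B → A ≈ 0#
  disjoint {A = A} {B} Q? Q#Q′ suppA suppB A≈B = ∣⇒≈0 λ n n<N → case n n<N (Q? n)
    where
    case : ∀ n → n < N → Dec _ → + m ∣ᶻ A n
    case n n<N (yes Qn) = ≈⇒∣ A≈B n n<N (suppB n (Q#Q′ n Qn))
    case n n<N (no ¬Qn) = subst (+ m ∣ᶻ_) (sym (suppA n ¬Qn)) (divides 0ℤ refl)

  -- Comparing exponents modulo `4 * a`.

  module _ (a : ℕ) .{{_ : NonZero a}} where

    -- n ≡ - r a (mod 4a), without subtraction
    Class : ℕ → ℕ → Set
    Class r n = 4 ℕ.* a ℕ∣.∣ n ℕ.+ r ℕ.* a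

    class? : ∀ r → Decidable (Class r)
    class? r n = 4 ℕ.* a ℕ∣.∣? (n ℕ.+ r ℕ.* a)

    class-+ : ∀ r s t e → r ℕ.+ s ≡ e ℕ.* 4 ℕ.+ t → ∀ i j → Class r i → Class s j → Class t (i ℕ.+ j)
    class-+ r s t e r+s≡ i j p q = ℕ∣.∣m+n∣m⇒∣n (subst (4 ℕ.* a ℕ∣.∣_) (begin
        i ℕ.+ r ℕ.* a ℕ.+ (j ℕ.+ s ℕ.* a)
          ≡⟨ solveℕ 5 (λ i j r s a → i :+ℕ r :*ℕ a :+ℕ (j :+ℕ s :*ℕ a) :=ℕ i :+ℕ j :+ℕ (r :+ℕ s) :*ℕ a) refl i j r s a ⟩
        i ℕ.+ j ℕ.+ (r ℕ.+ s) ℕ.* a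
          ≡⟨ cong (λ z → i ℕ.+ j ℕ.+ z ℕ.* a) r+s≡ ⟩
        i ℕ.+ j ℕ.+ (e ℕ.* 4 ℕ.+ t) ℕ.* a
          ≡⟨ solveℕ 5 (λ i j e t a → i :+ℕ j :+ℕ (e :*ℕ conℕ 4 :+ℕ t) :*ℕ a :=ℕ e :*ℕ (conℕ 4 :*ℕ a) :+ℕ (i :+ℕ j :+ℕ t :*ℕ a)) refl i j e t a ⟩
        e ℕ.* (4 ℕ.* a) ℕ.+ (i ℕ.+ j ℕ.+ t ℕ.* a) ∎)
      (ℕ∣.∣m∣n⇒∣m+n p q))
      (ℕ∣.n∣m*n e)
      where
      open ≡-Reasoning

    class-disjoint : ∀ n → Class 0 n → ¬ Class 2 n
    class-disjoint n p q = ℕ.<⇒≱ (ℕ.*-monoˡ-< a {2} {4} (s≤s (s≤s (s≤s z≤n))))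
      (ℕ∣.∣⇒≤ {{ℕ.m*n≢0 2 a}} (ℕ∣.∣m+n∣m⇒∣n {m = n} q (subst (4 ℕ.* a ℕ∣.∣_) (ℕ.+-identityʳ n) p)))

    module _ {b : ℕ} {x : Series} (suppx : Supp (_≡ b) x) where

      supp-even : ∀ r → Class r 0 → (∀ k → Class r (k ℕ.* 2 ℕ.* (k ℕ.* 2) ℕ.* b)) →
                  ∀ n → Supp (Class r) (θ-even n x)
      supp-even r c0 ck zero    = supp-one c0
      supp-even r c0 ck (suc n) = supp-⊕ (supp-even r c0 ck n) (supp-⊕ term term)
        where term = supp-at {Class r} (ck (suc n)) (supp-^ (suc n ℕ.* 2 ℕ.* (suc n ℕ.* 2)) suppx)

      supp-odd : ∀ r → (∀ k → Class r (suc (k ℕ.* 2) ℕ.* suc (k ℕ.* 2) ℕ.* b)) →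
                 ∀ n → Supp (Class r) (θ-odd n x)
      supp-odd r ck zero    = supp-0
      supp-odd r ck (suc n) = supp-⊕ (supp-odd r ck n) (supp-⊕ term term)
        where term = supp-at {Class r} (ck n) (supp-^ (suc (n ℕ.* 2) ℕ.* suc (n ℕ.* 2)) suppx)

    private
      x x² α β α₂ β₂ : Series
      x  = q^ a
      x² = x * x
      α  = θ-even N x
      β  = θ-odd N x
      α₂ = θ-even N x²
      β₂ = θ-odd N x²

      suppα : Supp (Class 0) α
      suppα = supp-even (supp-q^ a) 0 (ℕ∣._∣0 _) (λ k → ℕ∣.divides (k ℕ.* k)
        (solveℕ 2 (λ k a → k :*ℕ conℕ 2 :*ℕ (k :*ℕ conℕ 2) :*ℕ a :+ℕ conℕ 0 :*ℕ a :=ℕ k :*ℕ k :*ℕ (conℕ 4 :*ℕ a)) refl k a)) N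

      suppβ : Supp (Class 3) β
      suppβ = supp-odd (supp-q^ a) 3 (λ k → ℕ∣.divides (k ℕ.* k ℕ.+ k ℕ.+ 1)
        (solveℕ 2 (λ k a → (conℕ 1 :+ℕ k :*ℕ conℕ 2) :*ℕ (conℕ 1 :+ℕ k :*ℕ conℕ 2) :*ℕ a :+ℕ conℕ 3 :*ℕ a
          :=ℕ (k :*ℕ k :+ℕ k :+ℕ conℕ 1) :*ℕ (conℕ 4 :*ℕ a)) refl k a)) N

      suppα₂ : Supp (Class 0) α₂
      suppα₂ = supp-even (supp-⊛-≡ (supp-q^ a) (supp-q^ a)) 0 (ℕ∣._∣0 _) (λ k → ℕ∣.divides (2 ℕ.* k ℕ.* k)
        (solveℕ 2 (λ k a → k :*ℕ conℕ 2 :*ℕ (k :*ℕ conℕ 2) :*ℕ (a :+ℕ a) :+ℕ conℕ 0 :*ℕ a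
          :=ℕ conℕ 2 :*ℕ k :*ℕ k :*ℕ (conℕ 4 :*ℕ a)) refl k a)) N

      suppβ₂ : Supp (Class 2) β₂
      suppβ₂ = supp-odd (supp-⊛-≡ (supp-q^ a) (supp-q^ a)) 2 (λ k → ℕ∣.divides (2 ℕ.* k ℕ.* k ℕ.+ 2 ℕ.* k ℕ.+ 1)
        (solveℕ 2 (λ k a → (conℕ 1 :+ℕ k :*ℕ conℕ 2) :*ℕ (conℕ 1 :+ℕ k :*ℕ conℕ 2) :*ℕ (a :+ℕ a) :+ℕ conℕ 2 :*ℕ a
          :=ℕ (conℕ 2 :*ℕ k :*ℕ k :+ℕ conℕ 2 :*ℕ k :+ℕ conℕ 1) :*ℕ (conℕ 4 :*ℕ a)) refl k a)) N

      supp-product : ∀ r s t e → r ℕ.+ s ≡ e ℕ.* 4 ℕ.+ t → ∀ {A B} →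
                     Supp (Class r) A → Supp (Class s) B → Supp (Class t) (A ⊛ B)
      supp-product r s t e r+s≡ = supp-⊛ (class? r) (class? s) (class-+ r s t e r+s≡)

      -- The relation T P = U² reads α² - β² = (α₂ - β₂)². `E₀` gathers its terms with exponents 0
      -- modulo 4a, `E₂` those with exponents 2a, arranged so that the relation becomes `E₀ ≈ E₂`.
      -- An odd square is 1 modulo 4, which puts β in the class of a and β₂ in that of 2a.
      E₀ E₂ : Series
      E₀ = α * α - (α₂ * α₂ + β₂ * β₂)
      E₂ = β * β - double (α₂ * β₂)

      suppE₀ : Supp (Class 0) E₀
      suppE₀ = supp-⊕ (supp-product 0 0 0 0 refl suppα suppα)
        (supp-⊝ (supp-⊕ (supp-product 0 0 0 0 refl suppα₂ suppα₂) (supp-product 2 2 0 1 refl suppβ₂ suppβ₂)))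

      suppE₂ : Supp (Class 2) E₂
      suppE₂ = supp-⊕ (supp-product 3 3 2 1 refl suppβ suppβ) (supp-⊝ (supp-⊕ term term))
        where term = supp-product 0 2 2 0 refl suppα₂ suppβ₂

      E₀≈E₂ : E₀ ≈ E₂
      E₀≈E₂ = begin
        E₀
          ≈⟨ solve 4 (λ a b c d → a :* a :- (c :* c :+ d :* d) := (a :- b) :* (a :+ b) :+ (b :* b :- (c :* c :+ d :* d))) ≈-refl α β α₂ β₂ ⟩
        (α - β) * (α + β) + (β * β - (α₂ * α₂ + β₂ * β₂))
          ≈⟨ +-congʳ (*-cong (≈sym (θ-split N x)) (≈sym (θ-split⁻ N x))) ⟩
        θ L x * θ L (- x) + (β * β - (α₂ * α₂ + β₂ * β₂))
          ≈⟨ +-congʳ (≈trans (θθ⁻ a) (*-cong (θ-split N x²) (θ-split N x²))) ⟩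
        (α₂ - β₂) * (α₂ - β₂) + (β * β - (α₂ * α₂ + β₂ * β₂))
          ≈⟨ solve 3 (λ b c d → (c :- d) :* (c :- d) :+ (b :* b :- (c :* c :+ d :* d)) := b :* b :- (c :* d :+ c :* d)) ≈-refl β α₂ β₂ ⟩
        E₂ ∎
        where open import Relation.Binary.Reasoning.Setoid setoid

    -- The classical φ(q)² + φ(-q)² = 2 φ(q²)², at q^a. Congruent series with disjoint supports
    -- vanish, so `E₀` and `E₂` are both zero: α² = α₂² + β₂² and β² = 2 α₂ β₂, whence α² + β² = (α₂
    -- + β₂)².
    θ²+θ⁻² : θ L (- q^ a) * θ L (- q^ a) + θ L (q^ a) * θ L (q^ a) ≈
             double (θ L (- (q^ a * q^ a)) * θ L (- (q^ a * q^ a)))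
    θ²+θ⁻² = begin
      θ L (- x) * θ L (- x) + θ L x * θ L x
        ≈⟨ +-cong (*-cong (θ-split⁻ N x) (θ-split⁻ N x)) (*-cong (θ-split N x) (θ-split N x)) ⟩
      (α + β) * (α + β) + (α - β) * (α - β)
        ≈⟨ sum-of-squares {α} {β} {α₂} {β₂}
             (disjoint (class? 0) class-disjoint suppE₀ suppE₂ E₀≈E₂)
             (disjoint (class? 2) (λ n c₂ c₀ → class-disjoint n c₀ c₂) suppE₂ suppE₀ (≈sym E₀≈E₂)) ⟩
      double ((α₂ + β₂) * (α₂ + β₂))
        ≈⟨ double-cong (*-cong (θ-split⁻ N x²) (θ-split⁻ N x²)) ⟨
      double (θ L (- x²) * θ L (- x²)) ∎
      where open import Relation.Binary.Reasoning.Setoid setoid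

  -- Divisibility within the residue class 6 modulo 9.

  ¬not6 : ∀ n → n % 9 ≡ 6 → ¬ Residue not6 n
  ¬not6 n n≡6 n∈ with subst (_∈ not6) n≡6 n∈
  ... | there (there (there (there (there (there (there (there ())))))))

  -- Since B 0 = 1, the recursion for the coefficients of A stays inside the residue class 6.

  descent : ∀ {A B C} → B 0 ≡ 1ℤ → Supp (Residue (0 ∷ [])) B → Supp (Residue not6) C → B * A ≈ C →
            ∀ n → n < N → n % 9 ≡ 6 → + m ∣ᶻ A n
  descent {A} {B} {C} B0≡1 suppB suppC BA≈C = <-rec _ step
    where
    step : ∀ n → (∀ {k} → k < n → k < N → k % 9 ≡ 6 → + m ∣ᶻ A k) → n < N → n % 9 ≡ 6 → + m ∣ᶻ A n
    step zero    rec n<N ()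
    step (suc n) rec n<N n≡6 = subst (+ m ∣ᶻ_) (trans (cong (ℤ._* A (suc n)) B0≡1) (ℤ.*-identityˡ (A (suc n))))
      (ℤ∣.∣m+n∣n⇒∣m {m = B 0 ℤ.* A (suc n)}
        (≈⇒∣ BA≈C (suc n) n<N (suppC (suc n) (¬not6 (suc n) n≡6)))
        (∣-sum (suc n) (λ i → B (suc (toℕ i)) ℤ.* A (n ∸ toℕ i)) term))
      where
      term : ∀ (i : Fin (suc n)) → + m ∣ᶻ B (suc (toℕ i)) ℤ.* A (n ∸ toℕ i)
      term i with residue? (0 ∷ []) (suc (toℕ i))
      ... | no ¬0  = subst (λ b → + m ∣ᶻ b ℤ.* A (n ∸ toℕ i)) (sym (suppB _ ¬0)) (divides 0ℤ refl)
      ... | yes (here s≡0) = ℤ∣.∣n⇒∣m*n (B (suc (toℕ i)))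
            (rec (s≤s (ℕ.m∸n≤m n (toℕ i))) (ℕ.≤-<-trans (ℕ.≤-trans (ℕ.m∸n≤m n (toℕ i)) (ℕ.n≤1+n n)) n<N) (begin
              (n ∸ toℕ i) % 9                                       ≡⟨ m%n%n≡m%n (n ∸ toℕ i) 9 ⟨
              (n ∸ toℕ i) % 9 % 9                                   ≡⟨ cong (λ z → (z ℕ.+ (n ∸ toℕ i) % 9) % 9) s≡0 ⟨
              (suc (toℕ i) % 9 ℕ.+ (n ∸ toℕ i) % 9) % 9             ≡⟨ %-distribˡ-+ (suc (toℕ i)) (n ∸ toℕ i) 9 ⟨
              suc (toℕ i ℕ.+ (n ∸ toℕ i)) % 9                       ≡⟨ cong (λ z → suc z % 9) (ℕ.m+[n∸m]≡n (ℕ.≤-pred (toℕ<n i))) ⟩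
              suc n % 9                                             ≡⟨ n≡6 ⟩
              6                                                     ∎))
        where open ≡-Reasoning

  -- The generating function in terms of `T` and `U`.

  X X² T U : Series
  X  = q^ 1
  X² = X * X
  T  = θ L X
  U  = θ L X²

  X^≈0 : X ^ suc L ≈ 0#
  X^≈0 = supp-≈0 (ℕ.≤-trans N≤L (ℕ.≤-trans (ℕ.n≤1+n L) (ℕ.m≤m*n (suc L) 1))) (supp-^ (suc L) (supp-q^ 1))

  X²^≈0 : X² ^ suc L ≈ 0#
  X²^≈0 = supp-≈0 (ℕ.≤-trans N≤L (ℕ.≤-trans (ℕ.n≤1+n L) (ℕ.m≤m*n (suc L) 2)))
    (supp-^ (suc L) (supp-⊛-≡ (supp-q^ 1) (supp-q^ 1)))

  X²≈q² : X² ≈ q^ 2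
  X²≈q² = doubled 1 ≈-refl

  f₁² : f 1 * f 1 ≈ f 2 * T
  f₁² = begin
    f 1 * f 1              ≈⟨ *-cong (∏⁻≈f 1 ≈-refl) (∏⁻≈f 1 ≈-refl) ⟨
    ∏⁻ L X * ∏⁻ L X        ≈⟨ gauss L X X^≈0 ⟩
    ∏⁻ L X² * T            ≈⟨ *-congʳ (∏⁻≈f 2 X²≈q²) ⟩
    f 2 * T                ∎
    where open import Relation.Binary.Reasoning.Setoid setoid

  f₂² : f 2 * f 2 ≈ f 4 * U
  f₂² = begin
    f 2 * f 2              ≈⟨ *-cong (∏⁻≈f 2 X²≈q²) (∏⁻≈f 2 X²≈q²) ⟨
    ∏⁻ L X² * ∏⁻ L X²      ≈⟨ gauss L X² X²^≈0 ⟩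
    ∏⁻ L (X² * X²) * U     ≈⟨ *-congʳ (∏⁻≈f 4 (doubled 2 X²≈q²)) ⟩
    f 4 * U                ∎
    where open import Relation.Binary.Reasoning.Setoid setoid

  ā-exponent : ∀ d → + 2 ℤ.* + (2 ℕ.+ d) ℤ.- + 3 ≡ + suc (2 ℕ.* d)
  ā-exponent d = begin
    + 2 ℤ.* + (2 ℕ.+ d) ℤ.- + 3    ≡⟨ cong (ℤ._- + 3) (ℤ.pos-* 2 (2 ℕ.+ d)) ⟨
    + (2 ℕ.* (2 ℕ.+ d)) ℤ.- + 3    ≡⟨ cong (λ e → + e ℤ.- + 3) (ℕ.*-distribˡ-+ 2 2 d) ⟩
    + suc (2 ℕ.* d)                ∎
    where open ≡-Reasoning

  -- The series `ā c` enters the argument only as an inverse. For c = 2 + d both integer exponents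
  -- in its definition are positive, so `_^ᶻ_` is an ordinary power.
  Tā : ∀ d → T * U ^ suc d * ā (2 ℕ.+ d) ≈ 1#
  Tā d = begin
    T * U ^ suc d * ā (2 ℕ.+ d)
      ≡⟨ cong (λ A → T * U ^ suc d * A) ā≡ ⟩
    T * U ^ suc d * (f 4 ^ suc d * inv D)
      ≈⟨ *-assoc (T * U ^ suc d) (f 4 ^ suc d) (inv D) ⟨
    T * U ^ suc d * f 4 ^ suc d * inv D
      ≈⟨ *-congʳ (eta-quotient {f 1} {f 2} {f 4} {T} {U} d f₁² f₂²) ⟩
    D * inv D
      ≈⟨ ≗⇒≈ (inv-inverse D D0≡1) ⟩
    1# ∎
    where
    open import Relation.Binary.Reasoning.Setoid setoid
    D : Series
    D = f 1 ^ 2 * f 2 ^ suc (2 ℕ.* d)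
    D0≡1 : D 0 ≡ 1ℤ
    D0≡1 = cong₂ (λ x y → x ℤ.* y ℤ.+ 0ℤ) (^-constant {f 1} 2 refl) (^-constant {f 2} (suc (2 ℕ.* d)) refl)
    ā≡ : ā (2 ℕ.+ d) ≡ f 4 ^ suc d * inv D
    ā≡ = trans (cong (λ e → f 4 Defs.^ suc d ⊘ (f 1 Defs.^ 2 ⊛ f 2 ^ᶻ e)) (ā-exponent d))
      (cong₂ (λ Y Z → Y ⊘ (f 1 ^ 2 ⊛ Z)) (^≡ (f 4) (suc d)) (^≡ (f 2) (suc (2 ℕ.* d))))

-- Divisibility by 3.

module Modulo3 (N : ℕ) where

  open Truncated 3 N
  open CommutativeRing (truncatedRing 3 N)
    renaming (refl to ≈-refl; sym to ≈sym; trans to ≈trans; zero to *-zero)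
  open import Algebra.Properties.Semiring.Exp semiring
  open import Algebra.Properties.Ring ring using (-0#≈0#)

  three≈0 : 1# + 1# + 1# ≈ 0#
  three≈0 = mk λ { zero _ → divides 1ℤ refl ; (suc n) _ → divides 0ℤ refl }

  open Characteristic3 three≈0

  -- E(q^a) = E(q^(2a)) is iterated until the exponent reaches N; there q^a is zero in the truncated
  -- ring and both theta values are 1. The number `d` bounds the doublings still to come: a doubling
  -- raises `a` by at least one, so `d` may drop by one.
  quartic : ∀ d a .{{_ : NonZero a}} → N ≤ d ℕ.+ a → θ L (q^ a) ^ 4 + θ L (- q^ a) ^ 4 ≈ 1# + 1#
  quartic zero    a N≤a = +-cong (≈1 x≈0) (≈1 (≈trans (-‿cong x≈0) -0#≈0#))
    where
    x≈0 : q^ a ≈ 0#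
    x≈0 = supp-≈0 N≤a (supp-q^ a)
    ≈1 : ∀ {x} → x ≈ 0# → θ L x ^ 4 ≈ 1#
    ≈1 x≈0 = ≈trans (^-congˡ 4 (θ-0 L x≈0)) (1^n≈1 4)
      where
      1^n≈1 : ∀ n → 1# ^ n ≈ 1#
      1^n≈1 zero    = ≈-refl
      1^n≈1 (suc n) = ≈trans (*-identityˡ _) (1^n≈1 n)
  quartic (suc d) a@(suc a′) N≤d+a = ≈trans (fourthPowers {θ L (q^ a)} {θ L (- q^ a)} {θ L (q^ a * q^ a)} {θ L (- (q^ a * q^ a))} (θθ⁻ a) (θ²+θ⁻² a)) (≈trans
    (+-cong (^-congˡ 4 (θ-cong L x²)) (^-congˡ 4 (θ-cong L (-‿cong x²))))
    (quartic d (a ℕ.+ a) (ℕ.≤-trans N≤d+a (ℕ.≤-trans (ℕ.≤-reflexive (sym (ℕ.+-suc d a)))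
      (ℕ.+-monoʳ-≤ d (s≤s (ℕ.m≤n+m a a′)))))))
    where x² = doubled a ≈-refl

  P : Series
  P = θ L (- X)

  -X : Supp (_≡ 1) (- X)
  -X = supp-⊝ (supp-q^ 1)

  suppP : Supp (Residue squares) P
  suppP = supp-θ L (residue-square 1) -X

  suppT : Supp (Residue squares) T
  suppT = supp-θ L (residue-square 1) (supp-q^ 1)

  -- Stand-ins for P³, P⁹ and U⁹ that have the right support over ℤ. The cube of `P` itself has the
  -- term 6 q, invisible modulo 3 but not to `Supp`.
  P³ P⁹ Z : Series
  P³ = θ L ((- X) ^ 3)
  P⁹ = θ L (((- X) ^ 3) ^ 3)
  Z  = θ L ((X² ^ 3) ^ 3)

  P³≈ : P ^ 3 ≈ P³
  P³≈ = θ-cube L (- X)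

  suppP³ : Supp (Residue (0 ∷ 3 ∷ [])) P³
  suppP³ = supp-θ L (residue-square 3) (supp-^ 3 -X)

  suppP⁹ : Supp (Residue not6) P⁹
  suppP⁹ = supp-θ L (residue-square 9) (supp-^ 3 (supp-^ 3 -X))

  suppX¹⁸ : Supp (_≡ 18) ((X² ^ 3) ^ 3)
  suppX¹⁸ = supp-^ 3 (supp-^ 3 (supp-⊛-≡ (supp-q^ 1) (supp-q^ 1)))

  suppZ : Supp (Residue (0 ∷ [])) Z
  suppZ = supp-θ L (residue-square 18) suppX¹⁸

  U⁹≈Z : U ^ 9 ≈ Z
  U⁹≈Z = ≈trans (≈sym (^-assocʳ U 3 3)) (≈trans (^-congˡ 3 (θ-cube L X²)) (θ-cube L (X² ^ 3)))

  U^≈Z^ : ∀ j → U ^ 18 * U ^ (9 ℕ.* j) ≈ Z ^ (2 ℕ.+ j)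
  U^≈Z^ j = begin
    U ^ 18 * U ^ (9 ℕ.* j)    ≈⟨ ^-homo-* U 18 (9 ℕ.* j) ⟨
    U ^ (18 ℕ.+ 9 ℕ.* j)      ≈⟨ ^-congʳ U (ℕ.*-distribˡ-+ 9 2 j) ⟨
    U ^ (9 ℕ.* (2 ℕ.+ j))     ≈⟨ ^-assocʳ U 9 (2 ℕ.+ j) ⟨
    (U ^ 9) ^ (2 ℕ.+ j)       ≈⟨ ^-congˡ (2 ℕ.+ j) U⁹≈Z ⟩
    Z ^ (2 ℕ.+ j)             ∎
    where open import Relation.Binary.Reasoning.Setoid setoid

  -- The multiplier is congruent to Z^(2+j), which has constant term 1 and only exponents divisible
  -- by 9; such a factor can be removed without leaving the residue class 6.
  vanishing : ∀ {A C} j → Supp (Residue not6) C → U ^ 18 * U ^ (9 ℕ.* j) * A ≈ C →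
              ∀ n → n < N → n % 9 ≡ 6 → + 3 ∣ᶻ A n
  vanishing {A} {C} j suppC p = descent {A} {Z ^ (2 ℕ.+ j)} {C} (^-constant {Z} (2 ℕ.+ j) (θ-constant L suppX¹⁸))
    (supp-^-⊆ {Residue (0 ∷ [])} {Z} (residue? (0 ∷ [])) (here refl) (residue-+ {0 ∷ []} {0 ∷ []} {0 ∷ []}) (2 ℕ.+ j) suppZ) suppC
    (≈trans (*-congʳ (≈sym (U^≈Z^ j))) p)

  TP≈U² : T * P ≈ U * U
  TP≈U² = θθ⁻ 1

  supp-cube-⊛ : ∀ {A B} → Supp (Residue (0 ∷ 3 ∷ [])) A → Supp (Residue squares) B →
                Supp (Residue not6) (A ⊛ (B ⊛ B))
  supp-cube-⊛ {A} {B} suppA suppB =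
    supp-residue-⊛ {0 ∷ 3 ∷ []} {sumsOfTwoSquares} {not6} {A} {B ⊛ B} suppA
      (supp-residue-⊛ {squares} {squares} {sumsOfTwoSquares} {B} {B} suppB suppB)

  module _ {A : Series} (j : ℕ) where

    vanishing₈ : T * (U ^ 8 * U ^ (9 ℕ.* j)) * A ≈ 1# → ∀ n → n < N → n % 9 ≡ 6 → + 3 ∣ᶻ A n
    vanishing₈ TUA≈1 = vanishing {A} {⊝ (P³ * (P * P) + P⁹)} j
      (supp-⊝ (supp-⊕ (supp-cube-⊛ {P³} {P} suppP³ suppP) suppP⁹))
      (≈trans (quotient₈ {T} {P} {U} {U ^ (9 ℕ.* j)} {A} TP≈U² (quartic N 1 (ℕ.m≤m+n N 1)) TUA≈1)
        (-‿cong (+-cong (*-congʳ {P * P} P³≈) (≈trans (^-congˡ 3 P³≈) (θ-cube L ((- X) ^ 3))))))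

    vanishing₁₂ : T * (U ^ 12 * U ^ (9 ℕ.* j)) * A ≈ 1# → ∀ n → n < N → n % 9 ≡ 6 → + 3 ∣ᶻ A n
    vanishing₁₂ TUA≈1 = vanishing {A} {P³ * (T * T)} j (supp-cube-⊛ {P³} {T} suppP³ suppT)
      (≈trans (quotient₁₂ {T} {P} {U} {U ^ (9 ℕ.* j)} {A} TP≈U² TUA≈1) (*-congʳ {T * T} P³≈))

    vanishing₁₆ : T * (U ^ 16 * U ^ (9 ℕ.* j)) * A ≈ 1# → ∀ n → n < N → n % 9 ≡ 6 → + 3 ∣ᶻ A n
    vanishing₁₆ TUA≈1 = vanishing {A} {P} j (supp-θ L (residue-square 1) -X)
      (quotient₁₆ {T} {P} {U} {U ^ (9 ℕ.* j)} {A} TP≈U² TUA≈1)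

  Tā-split : ∀ {c} e j d → suc d ≡ e ℕ.+ 9 ℕ.* j → 2 ℕ.+ d ≡ c → T * (U ^ e * U ^ (9 ℕ.* j)) * ā c ≈ 1#
  Tā-split e j d d≡ refl = ≈trans
    (*-congʳ {ā (2 ℕ.+ d)} (*-congˡ {T} (≈trans (≈sym (^-homo-* U e (9 ℕ.* j))) (^-congʳ U (sym d≡)))))
    (Tā d)

-- Divisibility by 4, and the conclusion.

module Modulo4 (N : ℕ) where

  open Truncated 4 N
  open CommutativeRing (truncatedRing 4 N) using (_≈_; _+_; _-_; 0#; 1#)

  four≈0 : 1# + 1# + (1# + 1#) ≈ 0#
  four≈0 = mk λ { zero _ → divides 1ℤ refl ; (suc n) _ → divides 0ℤ refl }

  open Characteristic4 four≈0

  ā-divisible : ∀ {c} d → 2 ℕ.+ d ≡ c → ∀ n → n < N → n % 9 ≡ 6 → + 4 ∣ᶻ ā c n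
  ā-divisible d refl n n<N n≡6 = [ (λ p → ≈⇒∣ {ā (2 ℕ.+ d)} {T} p n n<N (suppT n (¬not6 n n≡6)))
                            , (λ p → ≈⇒∣ {ā (2 ℕ.+ d)} {T + U - 1#} p n n<N (suppTU n (¬not6 n n≡6)))
                            ]′ (quotient L X X² (suc d) {ā (2 ℕ.+ d)} (Tā d))
    where
    suppT : Supp (Residue not6) T
    suppT = supp-θ L (residue-square 1) (supp-q^ 1)
    suppTU : Supp (Residue not6) (T + U - 1#)
    suppTU = supp-⊕ (supp-⊕ suppT (supp-θ L (residue-square 2) (supp-⊛-≡ (supp-q^ 1) (supp-q^ 1))))
      (supp-⊝ (supp-one (here refl)))

12∣ : ∀ {z} → + 3 ∣ᶻ z → + 4 ∣ᶻ z → 12 ℕ∣.∣ ℤ.∣ z ∣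
12∣ 3∣z 4∣z = lcm-least {3} {4} (ℤ∣.∣⇒∣ᵤ 3∣z) (ℤ∣.∣⇒∣ᵤ 4∣z)

open import Data.Nat using (ℕ; _+_; _*_; _≥_)
open import Data.Integer using (+_)
open import Data.Integer.Divisibility using (_∣_)
open import Data.Product using (_×_)

theorem1p9 : ∀ (n i : ℕ) → i ≥ 1 →
    (+ 12 ∣ ā (9 * i) (9 * n + 6))
    × (+ 12 ∣ ā (9 * i + 4) (9 * n + 6))
    × (+ 12 ∣ ā (9 * i + 8) (9 * n + 6))
theorem1p9 n (suc j) _ =
    12∣ {ā (9 * suc j) t}
      -- With i = j + 1 the exponent c - 1 of U is 8 + 9j here and 12 + 9j, 16 + 9j in the other two
      -- cases; the parameter d = c - 2 is one less.
      (vanishing₈ {ā (9 * suc j)} j (Tā-split {9 * suc j} 8 j (7 + 9 * j) refl c₀) t n<N t≡6)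
      (ā-divisible {9 * suc j} (7 + 9 * j) c₀ t n<N t≡6)
  , 12∣ {ā (9 * suc j + 4) t}
      (vanishing₁₂ {ā (9 * suc j + 4)} j (Tā-split {9 * suc j + 4} 12 j (11 + 9 * j) refl c₄) t n<N t≡6)
      (ā-divisible {9 * suc j + 4} (11 + 9 * j) c₄ t n<N t≡6)
  , 12∣ {ā (9 * suc j + 8) t}
      (vanishing₁₆ {ā (9 * suc j + 8)} j (Tā-split {9 * suc j + 8} 16 j (15 + 9 * j) refl c₈) t n<N t≡6)
      (ā-divisible {9 * suc j + 8} (15 + 9 * j) c₈ t n<N t≡6)
  where
  t = 9 * n + 6
  -- Truncation at `suc t` is the coarsest that still retains the coefficient at `t`.
  open Modulo3 (suc t)
  open Modulo4 (suc t)
  n<N : t < suc t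
  n<N = ℕ.n<1+n t
  t≡6 : t % 9 ≡ 6
  t≡6 = trans (cong (_% 9) (trans (ℕ.+-comm (9 * n) 6) (cong (6 ℕ.+_) (ℕ.*-comm 9 n)))) ([m+kn]%n≡m%n 6 n 9)
  c₀ : 9 + 9 * j ≡ 9 * suc j
  c₀ = sym (ℕ.*-suc 9 j)
  c₄ : 13 + 9 * j ≡ 9 * suc j + 4
  c₄ = trans (cong (4 ℕ.+_) c₀) (ℕ.+-comm 4 (9 * suc j))
  c₈ : 17 + 9 * j ≡ 9 * suc j + 8
  c₈ = trans (cong (8 ℕ.+_) c₀) (ℕ.+-comm 8 (9 * suc j))
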